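{- Let $T\subset\mathbb{R}^d$ be a finite training set (data set), each point of $T$ having a known classification. All points identified as relevant by the relevant-points algorithm on input $T$ are relevant, both with respect to the whole data set $T$ and with respect to the subset $R\subseteq T$ of points identified by the algorithm.
   Context: Classifications are discrete; they are not assumed to be binary, and $T$ is not assumed to be in general position. Nearest-neighbor classification: from a set of classified points, the classification of a point of $\mathbb{R}^d$ is inferred to be the classification of the nearest point (in Euclidean distance) of the set. A point of a set $X$ of classified points is relevant with respect to $X$ if removing it from $X$ would change the nearest-neighbor classification of some points of $\mathbb{R}^d$. A Euclidean minimum spanning tree of $T$ is a minimum spanning tree of the complete graph on $T$ with edges weighted by Euclidean distance (equal distances are allowed, so there may be more than one). The extreme points of a finite set are the vertices of its convex hull. Inversion through the unit sphere centered at $r$ maps $x\ne r$ to $r+(x-r)/\|x-r\|^2$. The relevant-points algorithm, on input $T$: (1) Find a Euclidean minimum spanning tree of $T$. (2) Find the tree edges whose two endpoints have different classifications, and initialize the set $R$ of relevant points to consist of the endpoints of these edges. (3) For each relevant point $r$ added to $R$ (either initially or within this loop): (a) invert through the unit sphere centered at $r$ all of the training points whose classification differs from that of $r$, producing a point set $S_r$, including also $r$ itself in $S_r$; (b) identify the extreme points of $S_r$; (c) add to $R$ the training points corresponding to extreme points of $S_r$. The points identified by the algorithm are the points of the final set $R$. -}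

module Defs where

open import Algebra.Bundles using (CommutativeRing)
open import Data.Bool.Base using (Bool; false; if_then_else_; T; _∧_)
open import Data.Empty using (⊥-elim)
open import Data.Fin.Base using (Fin; zero; suc)
import Data.Fin.Properties as Fin
open import Data.Fin.Subset using (Subset; _∈_; _∉_; _∪_; _-_; _⊆_; ⁅_⁆; ⊥)
open import Data.List.Base using (List; _∷_; _∷ʳ_)
open import Data.List.Relation.Unary.Linked using (Linked)
open import Data.List.Relation.Unary.Unique.Propositional using (Unique)
open import Data.Nat.Base using (ℕ)
import Data.Nat.Base as ℕ
open import Data.Product.Base using (Σ; ∃; ∃-syntax; _×_; _,_; proj₁; proj₂)
open import Data.Sum.Base using (inj₁; inj₂)
open import Data.Vec.Functional using (Vector)
open import Function.Bundles using (_⇔_)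
open import Level using (0ℓ)
open import Relation.Binary.Bundles using (DecTotalOrder)
open import Relation.Binary.Construct.Closure.ReflexiveTransitive using (Star)
import Relation.Binary.Construct.NonStrictToStrict as NonStrictToStrict
open import Relation.Binary.Core using (Rel)
open import Relation.Binary.PropositionalEquality.Core using (_≡_; _≢_)
open import Relation.Binary.Structures using (IsDecTotalOrder)
open import Relation.Nullary.Decidable using (yes; no; does)
open import Relation.Nullary.Negation using (¬_)
open import Relation.Unary using (Pred; Satisfiable)

-- The library has no real numbers.  ℝ is characterised up to isomorphism as
-- the Dedekind-complete ordered field; decidability of the total order is the
-- classical trichotomy law.
record CompleteOrderedField : Set₁ where
  infix 4 _≤_
  field
    commutativeRing : CommutativeRing 0ℓ 0ℓ

  open CommutativeRing commutativeRing public hiding (zero)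

  field
    1≉0             : ¬ (1# ≈ 0#)
    inverse         : ∀ x → ¬ (x ≈ 0#) → ∃[ y ] x * y ≈ 1#
    _≤_             : Rel Carrier 0ℓ
    isDecTotalOrder : IsDecTotalOrder _≈_ _≤_
    +-monoʳ-≤       : ∀ z {x y} → x ≤ y → z + x ≤ z + y
    *-nonneg        : ∀ {x y} → 0# ≤ x → 0# ≤ y → 0# ≤ x * y

  UpperBound : Pred Carrier 0ℓ → Pred Carrier 0ℓ
  UpperBound P u = ∀ x → P x → x ≤ u

  field
    supremum : ∀ (P : Pred Carrier 0ℓ) → Satisfiable P → Satisfiable (UpperBound P) →
               ∃[ s ] UpperBound P s × (∀ u → UpperBound P u → s ≤ u)

  decTotalOrder : DecTotalOrder 0ℓ 0ℓ 0ℓ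
  decTotalOrder = record { isDecTotalOrder = isDecTotalOrder }

  open IsDecTotalOrder isDecTotalOrder public
    using (_≟_; _≤?_; total; antisym; ≤-respˡ-≈; ≤-respʳ-≈)
    renaming ( refl to ≤-refl; trans to ≤-trans; reflexive to ≤-reflexive )

  open NonStrictToStrict _≈_ _≤_ public using (_<_)

module RealNumbers (𝔽 : CompleteOrderedField) where
  open CompleteOrderedField 𝔽 public renaming (Carrier to ℝ; _-_ to _-ʳ_)
  open import Algebra.Properties.CommutativeMonoid.Sum +-commutativeMonoid public using (sum)
  open import Algebra.Properties.Ring ring using (-‿distribˡ-*; -‿distribʳ-*; -‿involutive)
  open import Algebra.Properties.AbelianGroup +-abelianGroup using (xyx⁻¹≈y)
  open import Algebra.Solver.Ring.NaturalCoefficients.Default commutativeSemiring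
    using (solve; _:=_; _:+_; _:*_; con)
  open import Relation.Binary.Reasoning.Setoid setoid

  -- The value at 0# is the junk value 0#.
  infix 8 _⁻¹
  _⁻¹ : ℝ → ℝ
  x ⁻¹ with x ≟ 0#
  ... | yes _  = 0#
  ... | no x≉0 = proj₁ (inverse x x≉0)

  ⁻¹-inverseʳ : ∀ x → ¬ (x ≈ 0#) → x * x ⁻¹ ≈ 1#
  ⁻¹-inverseʳ x x≉0 with x ≟ 0#
  ... | yes x≈0 = ⊥-elim (x≉0 x≈0)
  ... | no x≉0′ = proj₂ (inverse x x≉0′)

  ≤-resp : ∀ {x x′ y y′} → x ≈ x′ → y ≈ y′ → x ≤ y → x′ ≤ y′
  ≤-resp x≈ y≈ x≤y = ≤-respˡ-≈ x≈ (≤-respʳ-≈ y≈ x≤y)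

  +-mono-≤ : ∀ {x y u v} → x ≤ y → u ≤ v → x + u ≤ y + v
  +-mono-≤ {x} {y} {u} {v} x≤y u≤v = ≤-trans (+-monoʳ-≤ x u≤v)
    (≤-resp (+-comm v x) (+-comm v y) (+-monoʳ-≤ v x≤y))

  +-nonneg : ∀ {x y} → 0# ≤ x → 0# ≤ y → 0# ≤ x + y
  +-nonneg p q = ≤-respˡ-≈ (+-identityˡ 0#) (+-mono-≤ p q)

  x+[y-x]≈y : ∀ x y → x + (y -ʳ x) ≈ y
  x+[y-x]≈y x y = trans (sym (+-assoc x y (- x))) (xyx⁻¹≈y x y)

  ≤⇒0≤- : ∀ {x y} → x ≤ y → 0# ≤ y -ʳ x
  ≤⇒0≤- {x} {y} x≤y = ≤-resp (-‿inverseˡ x) (+-comm (- x) y) (+-monoʳ-≤ (- x) x≤y)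

  0≤-⇒≤ : ∀ {x y} → 0# ≤ y -ʳ x → x ≤ y
  0≤-⇒≤ {x} {y} p = ≤-resp (+-identityʳ x) (x+[y-x]≈y x y) (+-monoʳ-≤ x p)

  x≤x+y : ∀ {x y} → 0# ≤ y → x ≤ x + y
  x≤x+y {x} p = ≤-respˡ-≈ (+-identityʳ x) (+-monoʳ-≤ x p)

  x+y≤x⇒y≤0 : ∀ {x y} → x + y ≤ x → y ≤ 0#
  x+y≤x⇒y≤0 {x} {y} p = ≤-resp lhs (-‿inverseˡ x) (+-monoʳ-≤ (- x) p)
    where
    lhs : - x + (x + y) ≈ y
    lhs = trans (sym (+-assoc (- x) x y)) (trans (+-congʳ (-‿inverseˡ x)) (+-identityˡ y))

  *-monoˡ-≤ : ∀ {x y z} → 0# ≤ z → x ≤ y → z * x ≤ z * y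
  *-monoˡ-≤ {x} {y} {z} 0≤z x≤y = 0≤-⇒≤ (≤-respʳ-≈ eq (*-nonneg 0≤z (≤⇒0≤- x≤y)))
    where
    eq : z * (y -ʳ x) ≈ z * y -ʳ z * x
    eq = trans (distribˡ z y (- x)) (+-congˡ (sym (-‿distribʳ-* z x)))

  *-mono-≤ : ∀ {x y u v} → 0# ≤ x → 0# ≤ v → x ≤ y → u ≤ v → x * u ≤ y * v
  *-mono-≤ {x} {y} {u} {v} 0≤x 0≤v x≤y u≤v = ≤-trans (*-monoˡ-≤ 0≤x u≤v)
    (≤-resp (*-comm v x) (*-comm v y) (*-monoˡ-≤ 0≤v x≤y))

  x≤0⇒0≤-x : ∀ {x} → x ≤ 0# → 0# ≤ - x
  x≤0⇒0≤-x p = ≤-respʳ-≈ (+-identityˡ _) (≤⇒0≤- p)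

  x*x-nonneg : ∀ x → 0# ≤ x * x
  x*x-nonneg x with total 0# x
  ... | inj₁ 0≤x = *-nonneg 0≤x 0≤x
  ... | inj₂ x≤0 = ≤-respʳ-≈ eq (*-nonneg (x≤0⇒0≤-x x≤0) (x≤0⇒0≤-x x≤0))
    where
    eq : - x * - x ≈ x * x
    eq = begin
      - x * - x    ≈⟨ -‿distribʳ-* (- x) x ⟨
      - (- x * x)  ≈⟨ -‿cong (-‿distribˡ-* x x) ⟨
      - - (x * x)  ≈⟨ -‿involutive (x * x) ⟩
      x * x        ∎

  0≤1 : 0# ≤ 1#
  0≤1 = ≤-respʳ-≈ (*-identityˡ 1#) (x*x-nonneg 1#)

  ≰⇒≥ : ∀ {x y} → ¬ (x ≤ y) → y ≤ x
  ≰⇒≥ {x} {y} x≰y with total x y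
  ... | inj₁ x≤y = ⊥-elim (x≰y x≤y)
  ... | inj₂ y≤x = y≤x

  ≰⇒≉ : ∀ {x y} → ¬ (x ≤ y) → ¬ (x ≈ y)
  ≰⇒≉ x≰y x≈y = x≰y (≤-reflexive x≈y)

  ⁻¹-nonneg : ∀ {x} → 0# ≤ x → ¬ (x ≈ 0#) → 0# ≤ x ⁻¹
  ⁻¹-nonneg {x} 0≤x x≉0 = ≤-respʳ-≈ eq (*-nonneg 0≤x (x*x-nonneg (x ⁻¹)))
    where
    eq : x * (x ⁻¹ * x ⁻¹) ≈ x ⁻¹
    eq = begin
      x * (x ⁻¹ * x ⁻¹)  ≈⟨ *-assoc x (x ⁻¹) (x ⁻¹) ⟨
      x * x ⁻¹ * x ⁻¹    ≈⟨ *-congʳ (⁻¹-inverseʳ x x≉0) ⟩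
      1# * x ⁻¹          ≈⟨ *-identityˡ (x ⁻¹) ⟩
      x ⁻¹               ∎

  /-cancel : ∀ y x → ¬ (x ≈ 0#) → y * x ⁻¹ * x ≈ y
  /-cancel y x x≉0 = begin
    y * x ⁻¹ * x    ≈⟨ *-assoc y (x ⁻¹) x ⟩
    y * (x ⁻¹ * x)  ≈⟨ *-congˡ (trans (*-comm (x ⁻¹) x) (⁻¹-inverseʳ x x≉0)) ⟩
    y * 1#          ≈⟨ *-identityʳ y ⟩
    y               ∎

  x*x≈0⇒x≈0 : ∀ {x} → x * x ≈ 0# → x ≈ 0#
  x*x≈0⇒x≈0 {x} x²≈0 with x ≟ 0#
  ... | yes x≈0 = x≈0
  ... | no x≉0 = begin
    x               ≈⟨ /-cancel x x x≉0 ⟨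
    x * x ⁻¹ * x    ≈⟨ trans (*-comm _ x) (sym (*-assoc x x (x ⁻¹))) ⟩
    x * x * x ⁻¹    ≈⟨ trans (*-congʳ x²≈0) (zeroˡ (x ⁻¹)) ⟩
    0#              ∎

  squareRoot : ∀ a → 0# ≤ a → ∃[ s ] 0# ≤ s × s * s ≈ a
  squareRoot a 0≤a = s , 0≤s , antisym s²≤a a≤s²
    where
    P : Pred ℝ 0ℓ
    P t = t * t ≤ a

    bounded : UpperBound P (1# + a)
    bounded t t²≤a with total t 1#
    ... | inj₁ t≤1 = ≤-trans t≤1 (x≤x+y 0≤a)
    ... | inj₂ 1≤t = ≤-trans
      (≤-respˡ-≈ (*-identityʳ t) (*-monoˡ-≤ (≤-trans 0≤1 1≤t) 1≤t))
      (≤-trans t²≤a (≤-respʳ-≈ (+-comm a 1#) (x≤x+y 0≤1)))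

    P0 : P 0#
    P0 = ≤-respˡ-≈ (sym (zeroˡ 0#)) 0≤a

    lub = supremum P (0# , P0) (1# + a , bounded)

    s : ℝ
    s = proj₁ lub

    upper : UpperBound P s
    upper = proj₁ (proj₂ lub)

    least : ∀ u → UpperBound P u → s ≤ u
    least = proj₂ (proj₂ lub)

    0≤s : 0# ≤ s
    0≤s = upper 0# P0

    a≤s² : a ≤ s * s
    a≤s² with a ≤? s * s
    ... | yes p = p
    ... | no a≰s² = ⊥-elim (≰⇒≉ a≰s² a≈s²)
      where
      δ k m e : ℝ
      δ = a -ʳ s * s
      k = 1# + (s + s)
      m = k + δ
      e = δ * m ⁻¹

      0≤δ : 0# ≤ δ
      0≤δ = ≤⇒0≤- (≰⇒≥ a≰s²)

      0≤k : 0# ≤ k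
      0≤k = +-nonneg 0≤1 (+-nonneg 0≤s 0≤s)

      1≤m : 1# ≤ m
      1≤m = ≤-trans (x≤x+y (+-nonneg 0≤s 0≤s)) (x≤x+y 0≤δ)

      m≉0 : ¬ (m ≈ 0#)
      m≉0 m≈0 = 1≉0 (antisym (≤-respʳ-≈ m≈0 1≤m) 0≤1)

      0≤m : 0# ≤ m
      0≤m = ≤-trans 0≤1 1≤m

      0≤e : 0# ≤ e
      0≤e = *-nonneg 0≤δ (⁻¹-nonneg 0≤m m≉0)

      em≈δ : e * m ≈ δ
      em≈δ = /-cancel δ m m≉0

      e≤1 : e ≤ 1#
      e≤1 = ≤-resp (*-comm (m ⁻¹) δ)
        (trans (*-comm (m ⁻¹) m) (⁻¹-inverseʳ m m≉0))
        (*-monoˡ-≤ (⁻¹-nonneg 0≤m m≉0) (≤-respʳ-≈ (+-comm δ k) (x≤x+y 0≤k)))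

      ek≤δ : e * k ≤ δ
      ek≤δ = ≤-respʳ-≈ em≈δ (*-monoˡ-≤ 0≤e (x≤x+y 0≤δ))

      expand : s * s + e * (e + (s + s)) ≈ (s + e) * (s + e)
      expand = solve 2 (λ s e → s :* s :+ e :* (e :+ (s :+ s)) := (s :+ e) :* (s :+ e)) refl s e

      s+e∈P : P (s + e)
      s+e∈P = ≤-resp expand (x+[y-x]≈y (s * s) a)
        (+-monoʳ-≤ (s * s)
          (≤-trans (*-monoˡ-≤ 0≤e (+-mono-≤ e≤1 ≤-refl)) ek≤δ))

      e≈0 : e ≈ 0#
      e≈0 = antisym (x+y≤x⇒y≤0 (upper (s + e) s+e∈P)) 0≤e

      a≈s² : a ≈ s * s
      a≈s² = begin
        a          ≈⟨ x+[y-x]≈y (s * s) a ⟨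
        s * s + δ  ≈⟨ +-congˡ (trans (sym em≈δ) (trans (*-congʳ e≈0) (zeroˡ m))) ⟩
        s * s + 0# ≈⟨ +-identityʳ (s * s) ⟩
        s * s      ∎

    s²≤a : s * s ≤ a
    s²≤a with s * s ≤? a
    ... | yes p = p
    ... | no s²≰a = ⊥-elim (≰⇒≉ s²≰a s²≈a)
      where
      δ k e u : ℝ
      δ = s * s -ʳ a
      k = s + s
      e = δ * k ⁻¹
      u = s -ʳ e

      0≤δ : 0# ≤ δ
      0≤δ = ≤⇒0≤- (≰⇒≥ s²≰a)

      0≤k : 0# ≤ k
      0≤k = +-nonneg 0≤s 0≤s

      k≉0 : ¬ (k ≈ 0#)
      k≉0 k≈0 = s²≰a (≤-respˡ-≈ (sym (trans (*-congʳ s≈0) (zeroˡ s))) 0≤a)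
        where
        s≈0 : s ≈ 0#
        s≈0 = antisym (≤-respʳ-≈ k≈0 (x≤x+y 0≤s)) 0≤s

      0≤e : 0# ≤ e
      0≤e = *-nonneg 0≤δ (⁻¹-nonneg 0≤k k≉0)

      ek≈δ : e * k ≈ δ
      ek≈δ = /-cancel δ k k≉0

      s≈e+u : e + u ≈ s
      s≈e+u = x+[y-x]≈y e s

      s²≈a+ek : s * s ≈ a + e * k
      s²≈a+ek = trans (sym (x+[y-x]≈y a (s * s))) (+-congˡ (sym ek≈δ))

      +-cancelʳ′ : ∀ {x y} z → x + z ≈ y + z → x ≈ y
      +-cancelʳ′ {x} {y} z = +-cancelʳ z x y
        where open import Algebra.Properties.Group +-group using () renaming (∙-cancelʳ to +-cancelʳ)

      u²≈a+e² : u * u ≈ a + e * e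
      u²≈a+e² = +-cancelʳ′ (e * e + e * (u + u)) (begin
        u * u + (e * e + e * (u + u))        ≈⟨ solve 2 (λ u e → u :* u :+ (e :* e :+ e :* (u :+ u))
                                                             := (e :+ u) :* (e :+ u)) refl u e ⟩
        (e + u) * (e + u)                    ≈⟨ *-cong s≈e+u s≈e+u ⟩
        s * s                                ≈⟨ s²≈a+ek ⟩
        a + e * (s + s)                      ≈⟨ +-congˡ (*-congˡ (+-cong s≈e+u s≈e+u)) ⟨
        a + e * ((e + u) + (e + u))          ≈⟨ solve 3 (λ a u e → a :+ e :* ((e :+ u) :+ (e :+ u))
                                                             := a :+ e :* e :+ (e :* e :+ e :* (u :+ u)))
                                                        refl a u e ⟩
        a + e * e + (e * e + e * (u + u))    ∎)

      0≤u : 0# ≤ u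
      0≤u with 0# ≤? u
      ... | yes p = p
      ... | no 0≰u = ⊥-elim (s²≰a (≤-trans (x+y≤x⇒y≤0 2s²≤s²) 0≤a))
        where
        s≤e : s ≤ e
        s≤e = ≤-resp s≈e+u (+-identityʳ e) (+-monoʳ-≤ e (≰⇒≥ 0≰u))

        δ≤s² : δ ≤ s * s
        δ≤s² = 0≤-⇒≤ (≤-respʳ-≈ (sym a≈) 0≤a)
          where
          a≈ : s * s -ʳ δ ≈ a
          a≈ = +-cancelʳ′ δ (begin
            s * s -ʳ δ + δ  ≈⟨ trans (+-comm _ δ) (x+[y-x]≈y δ (s * s)) ⟩
            s * s           ≈⟨ x+[y-x]≈y a (s * s) ⟨
            a + δ           ∎)

        2s²≤s² : s * s + s * s ≤ s * s
        2s²≤s² = ≤-trans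
          (≤-resp (trans (*-comm k s) (distribˡ s s s)) (trans (*-comm k e) ek≈δ)
            (*-monoˡ-≤ 0≤k s≤e))
          δ≤s²

      e≉0 : ¬ (e ≈ 0#)
      e≉0 e≈0 = ≰⇒≉ s²≰a
        (trans s²≈a+ek (trans (+-congˡ (trans (*-congʳ e≈0) (zeroˡ k))) (+-identityʳ a)))

      u-upper : UpperBound P u
      u-upper t t²≤a with t ≤? u
      ... | yes p = p
      ... | no t≰u = ⊥-elim (e≉0 (x*x≈0⇒x≈0 (antisym e²≤0 (x*x-nonneg e))))
        where
        u≤t : u ≤ t
        u≤t = ≰⇒≥ t≰u

        e²≤0 : e * e ≤ 0#
        e²≤0 = x+y≤x⇒y≤0 (≤-respˡ-≈ u²≈a+e²
          (≤-trans (*-mono-≤ 0≤u (≤-trans 0≤u u≤t) u≤t u≤t) t²≤a))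

      s²≈a : s * s ≈ a
      s²≈a = ⊥-elim (e≉0 (antisym e≤0 0≤e))
        where
        e≤0 : e ≤ 0#
        e≤0 = x+y≤x⇒y≤0 (≤-respˡ-≈ (trans (sym s≈e+u) (+-comm e u)) (least u u-upper))

module Euclidean (𝔽 : CompleteOrderedField) where
  open RealNumbers 𝔽 public
  open import Data.Vec.Functional.Relation.Binary.Equality.Setoid setoid public using (_≋_)

  Point : ℕ → Set
  Point d = Vector ℝ d

  module _ {d : ℕ} where
    infixl 6 _+ᵛ_ _-ᵛ_
    infixr 7 _*ᵛ_

    _+ᵛ_ _-ᵛ_ : Point d → Point d → Point d
    (x +ᵛ y) i = x i + y i
    (x -ᵛ y) i = x i -ʳ y i

    _*ᵛ_ : ℝ → Point d → Point d
    (a *ᵛ x) i = a * x i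

  ‖_‖² : ∀ {d} → Point d → ℝ
  ‖ x ‖² = sum λ i → x i * x i

  ‖‖²-nonneg : ∀ {d} (x : Point d) → 0# ≤ ‖ x ‖²
  ‖‖²-nonneg {ℕ.zero}  x = ≤-refl
  ‖‖²-nonneg {ℕ.suc d} x = +-nonneg (x*x-nonneg (x zero)) (‖‖²-nonneg λ i → x (suc i))

  ‖_‖ : ∀ {d} → Point d → ℝ
  ‖ x ‖ = proj₁ (squareRoot ‖ x ‖² (‖‖²-nonneg x))

  dist : ∀ {d} → Point d → Point d → ℝ
  dist x y = ‖ x -ᵛ y ‖

  -- Only meaningful for x different from r.
  invert : ∀ {d} → Point d → Point d → Point d
  invert r x = r +ᵛ ‖ x -ᵛ r ‖² ⁻¹ *ᵛ (x -ᵛ r)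

  ConvexHull : ∀ {d} → Pred (Point d) 0ℓ → Pred (Point d) 0ℓ
  ConvexHull S x = ∃[ k ] Σ (Vector ℝ k) λ w → Σ (Vector (Point _) k) λ p →
    (∀ i → 0# ≤ w i) × sum w ≈ 1# × (∀ i → S (p i)) × x ≋ (λ j → sum λ i → w i * p i j)

  -- The vertices of the convex hull: its points that lie in no open segment
  -- between two distinct points of the hull.
  Extreme : ∀ {d} → Pred (Point d) 0ℓ → Pred (Point d) 0ℓ
  Extreme S v = ConvexHull S v ×
    (∀ x y t → ConvexHull S x → ConvexHull S y → 0# < t → t < 1# →
      v ≋ (1# -ʳ t) *ᵛ x +ᵛ t *ᵛ y → x ≋ v × y ≋ v)

record Graph (n : ℕ) : Set where
  field
    adjacent    : Fin n → Fin n → Bool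
    symmetric   : ∀ i j → adjacent i j ≡ adjacent j i
    irreflexive : ∀ i → adjacent i i ≡ false

  Edge : Rel (Fin n) 0ℓ
  Edge i j = T (adjacent i j)

  Connected : Set
  Connected = ∀ i j → Star Edge i j

  -- The vertices u, v, w, vs… of a cycle are at least three; it closes back to u.
  IsCycle : Fin n → Fin n → Fin n → List (Fin n) → Set
  IsCycle u v w vs = Unique (u ∷ v ∷ w ∷ vs) × Linked Edge ((u ∷ v ∷ w ∷ vs) ∷ʳ u)

  Acyclic : Set
  Acyclic = ∀ u v w vs → ¬ IsCycle u v w vs

  IsTree : Set
  IsTree = Connected × Acyclic

record TrainingSet (𝔽 : CompleteOrderedField) (d n : ℕ) (C : Set) : Set where
  open Euclidean 𝔽
  field
    point    : Fin n → Point d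
    distinct : ∀ {i j} → point i ≋ point j → i ≡ j
    class    : Fin n → C

module NearestNeighbor {𝔽 : CompleteOrderedField} {d n : ℕ} {C : Set}
                       (D : TrainingSet 𝔽 d n C) where
  open Euclidean 𝔽
  open TrainingSet D

  -- Sets of training points are given by their sets of indices.

  IsNearest : Subset n → Point d → Fin n → Set
  IsNearest X q i = i ∈ X × (∀ j → j ∈ X → dist q (point i) ≤ dist q (point j))

  -- When several points are nearest, q has a classification only if these
  -- points agree on it; when X is empty, q has none.
  Classifies : Subset n → Point d → C → Set
  Classifies X q c = (∃[ i ] IsNearest X q i) × (∀ i → IsNearest X q i → class i ≡ c)

  -- Both classifications of q are required to be determined.
  Relevant : Subset n → Fin n → Set
  Relevant X i = i ∈ X × (∃[ q ] ∃[ c ] ∃[ c′ ]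
    Classifies X q c × Classifies (X - i) q c′ × c ≢ c′)

module Algorithm {𝔽 : CompleteOrderedField} {d n : ℕ} {C : Set}
                 (D : TrainingSet 𝔽 d n C) where
  open Euclidean 𝔽
  open TrainingSet D
  open Graph using (adjacent; Edge; IsTree)

  -- The test i < j makes each undirected edge count once.
  weight : Graph n → ℝ
  weight G = sum λ i → sum λ j →
    if does (i Fin.<? j) ∧ adjacent G i j then dist (point i) (point j) else 0#

  IsMinimumSpanningTree : Graph n → Set
  IsMinimumSpanningTree G = IsTree G × (∀ H → IsTree H → weight G ≤ weight H)

  BichromaticEndpoint : Graph n → Fin n → Set
  BichromaticEndpoint G i = ∃[ j ] Edge G i j × class i ≢ class j

  data InvertedImage (r : Fin n) : Fin n → Point d → Set where
    itself : InvertedImage r r (point r)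
    other  : ∀ {j} → class j ≢ class r → InvertedImage r j (invert (point r) (point j))

  Inverted : Fin n → Pred (Point d) 0ℓ
  Inverted r x = ∃[ j ] ∃[ y ] InvertedImage r j y × x ≋ y

  CorrespondsToExtreme : Fin n → Fin n → Set
  CorrespondsToExtreme r j = ∃[ y ] InvertedImage r j y × Extreme (Inverted r) y

  -- Run G R P: starting from the tree G, the loop can reach a state in which R
  -- has been found so far and the points of P have been processed.
  data Run (G : Graph n) : Subset n → Subset n → Set where
    initial : ∀ {R} → (∀ i → i ∈ R ⇔ BichromaticEndpoint G i) → Run G R ⊥
    process : ∀ {R P} r E → Run G R P → r ∈ R → r ∉ P →
              (∀ j → j ∈ E ⇔ CorrespondsToExtreme r j) → Run G (R ∪ E) (P ∪ ⁅ r ⁆)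

  -- The minimum spanning tree and the processing order are arbitrary.
  Output : Subset n → Set
  Output R = ∃[ G ] ∃[ P ] IsMinimumSpanningTree G × Run G R P × R ⊆ P

{-# OPTIONS --safe #-}
-- Suppose that a closed ball has the training point j on its boundary, contains
-- r, which has another class, and contains no further point of a class other
-- than that of r.  Shrink the ball towards j until it has just lost its last
-- point of the class of r: for its center, j is the unique nearest point, and the
-- next nearest points all have the class of r.  So j is relevant with respect to
-- every set containing j and r.  It remains to find such balls.  For a
-- bichromatic edge of the minimum spanning tree, take the ball having the edge
-- as its diameter; a third point in it could replace one end of the edge and
-- make the tree lighter.  For an extreme point found by inversion about r, some
-- hyperplane strictly separates it from the rest of the inverted set, and the
-- parallel hyperplane through it is inverted to the boundary of the ball.
module Submission where

open import Defs
open import Algebra.Bundles using (CommutativeRing)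
open import Data.Bool.Base using (Bool; true; false; if_then_else_; T; _∧_)
import Data.Bool.Properties as Bool
open import Data.Fin.Base as Fin using (Fin; zero; suc; splitAt)
import Data.Fin.Properties as Fin
open import Data.Fin.Subset using (Subset; _∈_; _∉_; ⊤) renaming (_-_ to _∖_)
open import Data.Fin.Subset.Properties
  using (_∈?_; x∈p∧x≢y⇒x∈p-y; p─q⊆p; x∈p∪q⁻; x∈p∪q⁺; ∈⊤)
open import Data.Integer.Base using (0ℤ; 1ℤ)
open import Data.List.Base using (List; []; _∷_; _∷ʳ_; allFin; cartesianProduct; cartesianProductWith; filter; map)
open import Data.List.Extrema using (argmin; argmin-all; f[argmin]≤f[xs])
open import Data.List.Membership.Propositional.Properties
  using (∈-allFin; ∈-cartesianProduct⁺; ∈-cartesianProductWith⁺; ∈-filter⁺)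
open import Data.List.Relation.Unary.All as All using (All; []; _∷_)
import Data.List.Relation.Unary.All.Properties as All
open import Data.List.Relation.Unary.AllPairs using (_∷_)
open import Data.List.Relation.Unary.Linked using (Linked; _∷_)
open import Data.Nat.Base as ℕ using (ℕ; zero; suc)
import Data.Nat.Properties as ℕ
open import Data.Product.Base using (∃; ∃-syntax; _×_; _,_; proj₁; proj₂; uncurry)
open import Data.Sum.Base as Sum using (_⊎_; inj₁; inj₂)
open import Data.Vec.Base using (there) renaming (_∷_ to _∷ᵛ_)
open import Data.Vec.Functional as Vector using (Vector)
import Data.Vec.Functional.Relation.Unary.All.Properties as VectorAll
open import Function.Base using (_∘_; id)
open import Function.Bundles using (mk⇔; Equivalence)
open import Level using (0ℓ)
open import Relation.Binary.Bundles using (DecTotalOrder)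
open import Relation.Binary.Construct.Closure.ReflexiveTransitive as Star
  using (Star; ε; _◅_; _◅◅_; return; kleisliStar)
import Relation.Binary.Construct.NonStrictToStrict as NonStrictToStrict
open import Relation.Binary.Core using (Rel)
open import Relation.Binary.Definitions using (DecidableEquality; Symmetric; tri<; tri≈; tri>)
  renaming (Decidable to Decidable₂)
open import Relation.Binary.PropositionalEquality as ≡ using (_≡_; _≢_)
open import Relation.Nullary.Decidable
  using (Dec; yes; no; does; isYes; isYes≗does; does-⇔; dec-false; toWitness; fromWitness; T?;
         ¬?; _×-dec_; _⊎-dec_; decidable-stable; ¬¬-excluded-middle)
open import Relation.Nullary.Negation using (¬_; contradiction; ¬¬-map)
open import Relation.Unary using (Pred; Decidable)

-- Polynomial identities with subtraction, by a ring solver with integer coefficients.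

module IntegerSolver {c ℓ} (R : CommutativeRing c ℓ) where
  open CommutativeRing R
  open import Data.Integer.Base as ℤ using (ℤ; +_; -[1+_])
  import Data.Integer.Properties as ℤ
  open import Data.Maybe.Base as Maybe using (Maybe)
  open import Relation.Binary.Consequences using (dec⇒weaklyDec)
  open import Algebra.Solver.Ring.AlmostCommutativeRing
  open import Algebra.Properties.Semiring.Mult.TCOptimised semiring
    using (×-homo-+; ×1-homo-*; 1+×) renaming (_×_ to _·_)
  open import Algebra.Properties.Ring ring using (-‿distribˡ-*; -‿distribʳ-*; -‿involutive; -0#≈0#)
  open import Algebra.Properties.AbelianGroup +-abelianGroup using (⁻¹-∙-comm)
  open import Relation.Binary.Reasoning.Setoid setoid

  private
    -- Integers serve as coefficients because their equality computes, so that cancelling terms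
    -- really vanish from normal forms.
    ⟦_⟧ : ℤ → Carrier
    ⟦ + n ⟧      = n · 1#
    ⟦ -[1+ n ] ⟧ = - (suc n · 1#)

    -homo : ∀ i → ⟦ ℤ.- i ⟧ ≈ - ⟦ i ⟧
    -homo (+ zero)   = sym -0#≈0#
    -homo (+ suc n)  = refl
    -homo -[1+ n ]   = sym (-‿involutive _)

    ⊖-homo : ∀ m n → ⟦ m ℤ.⊖ n ⟧ ≈ m · 1# - n · 1#
    ⊖-homo m       zero    = sym (trans (+-congˡ -0#≈0#) (+-identityʳ _))
    ⊖-homo zero    (suc n) = sym (+-identityˡ _)
    ⊖-homo (suc m) (suc n) = begin
      ⟦ suc m ℤ.⊖ suc n ⟧                ≡⟨ ≡.cong ⟦_⟧ (ℤ.[1+m]⊖[1+n]≡m⊖n m n) ⟩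
      ⟦ m ℤ.⊖ n ⟧                        ≈⟨ ⊖-homo m n ⟩
      m · 1# - n · 1#                    ≈⟨ +-congʳ (trans (+-comm _ 0#) (+-identityˡ _)) ⟨
      -- The inserted 1# - 1# supplies the unit of each of the two successors.
      m · 1# + 0# - n · 1#               ≈⟨ +-congʳ (+-congˡ (-‿inverseʳ 1#)) ⟨
      m · 1# + (1# - 1#) - n · 1#        ≈⟨ trans (+-congʳ (sym (+-assoc _ _ _))) (+-assoc _ _ _) ⟩
      m · 1# + 1# + (- 1# - n · 1#)      ≈⟨ +-cong (+-comm _ _) (⁻¹-∙-comm _ _) ⟩
      1# + m · 1# - (1# + n · 1#)        ≈⟨ +-cong (1+× m 1#) (-‿cong (1+× n 1#)) ⟨
      suc m · 1# - suc n · 1#            ∎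

    +-homo : ∀ i j → ⟦ i ℤ.+ j ⟧ ≈ ⟦ i ⟧ + ⟦ j ⟧
    +-homo (+ m)    (+ n)    = ×-homo-+ 1# m n
    +-homo (+ m)    -[1+ n ] = ⊖-homo m (suc n)
    +-homo -[1+ m ] (+ n)    = trans (⊖-homo n (suc m)) (+-comm _ _)
    +-homo -[1+ m ] -[1+ n ] = begin
      ⟦ -[1+ m ] ℤ.+ -[1+ n ] ⟧            ≡⟨ ≡.cong ⟦_⟧ (ℤ.neg-distrib-+ (+ suc m) (+ suc n)) ⟨
      ⟦ ℤ.- (+ suc m ℤ.+ + suc n) ⟧        ≈⟨ -homo (+ suc m ℤ.+ + suc n) ⟩
      - ((suc m ℕ.+ suc n) · 1#)           ≈⟨ -‿cong (×-homo-+ 1# (suc m) (suc n)) ⟩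
      - (suc m · 1# + suc n · 1#)          ≈⟨ ⁻¹-∙-comm _ _ ⟨
      - (suc m · 1#) - suc n · 1#          ∎

    *-homo⁺ : ∀ m j → ⟦ + m ℤ.* j ⟧ ≈ m · 1# * ⟦ j ⟧
    *-homo⁺ m (+ n)    = begin
      ⟦ + m ℤ.* + n ⟧   ≡⟨ ≡.cong ⟦_⟧ (ℤ.pos-* m n) ⟨
      (m ℕ.* n) · 1#    ≈⟨ ×1-homo-* m n ⟩
      m · 1# * n · 1#   ∎
    *-homo⁺ m -[1+ n ] = begin
      ⟦ + m ℤ.* -[1+ n ] ⟧         ≡⟨ ≡.cong ⟦_⟧ (ℤ.neg-distribʳ-* (+ m) (+ suc n)) ⟨
      ⟦ ℤ.- (+ m ℤ.* + suc n) ⟧    ≈⟨ -homo (+ m ℤ.* + suc n) ⟩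
      - ⟦ + m ℤ.* + suc n ⟧        ≈⟨ -‿cong (*-homo⁺ m (+ suc n)) ⟩
      - (m · 1# * suc n · 1#)      ≈⟨ -‿distribʳ-* _ _ ⟩
      m · 1# * - (suc n · 1#)      ∎

    *-homo : ∀ i j → ⟦ i ℤ.* j ⟧ ≈ ⟦ i ⟧ * ⟦ j ⟧
    *-homo (+ m)    j = *-homo⁺ m j
    *-homo -[1+ m ] j = begin
      ⟦ -[1+ m ] ℤ.* j ⟧          ≡⟨ ≡.cong ⟦_⟧ (ℤ.neg-distribˡ-* (+ suc m) j) ⟨
      ⟦ ℤ.- (+ suc m ℤ.* j) ⟧     ≈⟨ -homo (+ suc m ℤ.* j) ⟩
      - ⟦ + suc m ℤ.* j ⟧         ≈⟨ -‿cong (*-homo⁺ (suc m) j) ⟩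
      - (suc m · 1# * ⟦ j ⟧)      ≈⟨ -‿distribˡ-* _ _ ⟩
      - (suc m · 1#) * ⟦ j ⟧      ∎

    homomorphism : ℤ.+-*-rawRing -Raw-AlmostCommutative⟶ fromCommutativeRing R
    homomorphism = record
      { ⟦_⟧ = ⟦_⟧ ; +-homo = +-homo ; *-homo = *-homo ; -‿homo = -homo ; 0-homo = refl ; 1-homo = refl }

    dec : ∀ i j → Maybe (⟦ i ⟧ ≈ ⟦ j ⟧)
    dec i j = Maybe.map (λ { ≡.refl → refl }) (dec⇒weaklyDec ℤ._≟_ i j)

  open import Algebra.Solver.Ring _ _ homomorphism dec public
    using (solve; _:=_; _:+_; _:*_; _:-_; :-_; con)

-- Strict order in an ordered field.

module OrderedField (𝔽 : CompleteOrderedField) where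
  open RealNumbers 𝔽 public
  open IntegerSolver commutativeRing public
  private module < = NonStrictToStrict _≈_ _≤_

  <-resp : ∀ {x x′ y y′} → x ≈ x′ → y ≈ y′ → x < y → x′ < y′
  <-resp x≈ y≈ (x≤y , x≉y) = ≤-resp x≈ y≈ x≤y , λ x′≈y′ → x≉y (trans x≈ (trans x′≈y′ (sym y≈)))

  ≰⇒> : ∀ {x y} → ¬ (x ≤ y) → y < x
  ≰⇒> = <.≰⇒> sym ≤-reflexive total

  <⇒≱ : ∀ {x y} → x < y → ¬ (y ≤ x)
  <⇒≱ = <.<⇒≱ antisym

  ≤-<-trans : ∀ {x y z} → x ≤ y → y < z → x < z
  ≤-<-trans = <.≤-<-trans ≤-trans antisym ≤-respˡ-≈

  <-≤-trans : ∀ {x y z} → x < y → y ≤ z → x < z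
  <-≤-trans = <.<-≤-trans sym ≤-trans antisym ≤-respʳ-≈

  ≮⇒≥ : ∀ {x y} → ¬ (x < y) → y ≤ x
  ≮⇒≥ {x} {y} x≮y with y ≤? x
  ... | yes y≤x = y≤x
  ... | no  y≰x = contradiction (≰⇒> y≰x) x≮y

  _<?_ : ∀ x y → Dec (x < y)
  _<?_ = <.<-decidable _≟_ _≤?_

  <⇒0<- : ∀ {x y} → x < y → 0# < y -ʳ x
  <⇒0<- {x} {y} x<y = ≰⇒> λ y-x≤0 → <⇒≱ x<y
    (0≤-⇒≤ (≤-respʳ-≈ (solve 2 (λ x y → :- (y :- x) := x :- y) refl x y) (x≤0⇒0≤-x y-x≤0)))

  0<-⇒< : ∀ {x y} → 0# < y -ʳ x → x < y
  0<-⇒< {x} {y} (0≤ , 0≉) = 0≤-⇒≤ 0≤ , λ x≈y → 0≉ (sym (trans (+-congˡ (-‿cong x≈y)) (-‿inverseʳ y)))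

  0<1 : 0# < 1#
  0<1 = 0≤1 , λ 0≈1 → 1≉0 (sym 0≈1)

  pos⇒≉0 : ∀ {x} → 0# < x → ¬ (x ≈ 0#)
  pos⇒≉0 (_ , 0≉x) x≈0 = 0≉x (sym x≈0)

  +-pos-nonneg : ∀ {x y} → 0# < x → 0# ≤ y → 0# < x + y
  +-pos-nonneg 0<x 0≤y = <-≤-trans 0<x (x≤x+y 0≤y)

  +-nonneg-pos : ∀ {x y} → 0# ≤ x → 0# < y → 0# < x + y
  +-nonneg-pos {x} {y} 0≤x 0<y = <-resp refl (+-comm y x) (+-pos-nonneg 0<y 0≤x)

  +-pos : ∀ {x y} → 0# < x → 0# < y → 0# < x + y
  +-pos 0<x 0<y = +-pos-nonneg 0<x (proj₁ 0<y)

  *-pos : ∀ {x y} → 0# < x → 0# < y → 0# < x * y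
  *-pos {x} {y} 0<x 0<y = *-nonneg (proj₁ 0<x) (proj₁ 0<y) , λ 0≈xy → pos⇒≉0 0<x
    (trans (sym (*-identityʳ x)) (trans (*-congˡ (sym (⁻¹-inverseʳ y (pos⇒≉0 0<y))))
      (trans (sym (*-assoc x y (y ⁻¹))) (trans (*-congʳ (sym 0≈xy)) (zeroˡ (y ⁻¹))))))

  ⁻¹-pos : ∀ {x} → 0# < x → 0# < x ⁻¹
  ⁻¹-pos {x} 0<x = ⁻¹-nonneg (proj₁ 0<x) (pos⇒≉0 0<x) , λ 0≈x⁻¹ →
    1≉0 (trans (sym (⁻¹-inverseʳ x (pos⇒≉0 0<x))) (trans (*-congˡ (sym 0≈x⁻¹)) (zeroʳ x)))

  *⁻¹≈1 : ∀ {x} → 0# < x → x * x ⁻¹ ≈ 1#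
  *⁻¹≈1 0<x = ⁻¹-inverseʳ _ (pos⇒≉0 0<x)

  *-cancel-0 : ∀ {c x} → 0# < c → c * x ≈ 0# → x ≈ 0#
  *-cancel-0 {c} {x} 0<c cx≈0 = trans (sym (/-cancel x c (pos⇒≉0 0<c)))
    (trans (solve 3 (λ x e c → x :* e :* c := e :* (c :* x)) refl x (c ⁻¹) c) (trans (*-congˡ cx≈0) (zeroʳ (c ⁻¹))))

  x<x+1 : ∀ x → x < x + 1#
  x<x+1 x = 0<-⇒< (<-resp refl (solve 2 (λ x o → o := x :+ o :- x) refl x 1#) 0<1)

  x-1<x : ∀ x → x -ʳ 1# < x
  x-1<x x = 0<-⇒< (<-resp refl (solve 2 (λ x o → o := x :- (x :- o)) refl x 1#) 0<1)

  0<2 : 0# < 1# + 1#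
  0<2 = +-pos 0<1 0<1

  midpoint : ∀ {x y} → x < y → ∃[ z ] x < z × z < y
  midpoint {x} {y} x<y = x + δ , 0<-⇒< (<-resp refl (solve 2 (λ x δ → δ := x :+ δ :- x) refl x δ) 0<δ)
                               , 0<-⇒< (<-resp refl eq 0<δ)
    where
    open import Relation.Binary.Reasoning.Setoid setoid
    δ = (y -ʳ x) * (1# + 1#) ⁻¹
    0<δ : 0# < δ
    0<δ = *-pos (<⇒0<- x<y) (⁻¹-pos 0<2)
    eq : δ ≈ y -ʳ (x + δ)
    eq = begin
      δ                          ≈⟨ solve 2 (λ o δ → δ := δ :* (con 1ℤ :+ con 1ℤ) :- δ) refl 1# δ ⟩
      δ * (1# + 1#) -ʳ δ         ≈⟨ +-congʳ (/-cancel _ _ (pos⇒≉0 0<2)) ⟩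
      y -ʳ x -ʳ δ                ≈⟨ solve 3 (λ x y δ → y :- x :- δ := y :- (x :+ δ)) refl x y δ ⟩
      y -ʳ (x + δ)               ∎

  module _ {A B : Set} (f : A → ℝ) (g : B → ℝ) where

    strictLowerBound : ∀ bs → ∃[ x ] All (λ b → x < g b) bs
    strictLowerBound []       = 0# , []
    strictLowerBound (b ∷ bs) with strictLowerBound bs
    ... | x , x<bs with x <? g b
    ...   | yes x<b = x , x<b ∷ x<bs
    ...   | no  x≮b = g b -ʳ 1# , x-1<x (g b) ∷ All.map (λ x<b′ → ≤-<-trans
              (≤-trans (proj₁ (x-1<x (g b))) (≮⇒≥ x≮b)) x<b′) x<bs

    strictlyBelow : ∀ l bs → All (λ b → l < g b) bs → ∃[ x ] l < x × All (λ b → x < g b) bs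
    strictlyBelow l []       []            = l + 1# , x<x+1 l , []
    strictlyBelow l (b ∷ bs) (l<b ∷ l<bs) with strictlyBelow l bs l<bs
    ... | x , l<x , x<bs with g b ≤? x
    ...   | no  b≰x = x , l<x , ≰⇒> b≰x ∷ x<bs
    ...   | yes b≤x = let m , l<m , m<b = midpoint l<b in
                      m , l<m , m<b ∷ All.map (≤-<-trans (≤-trans (proj₁ m<b) b≤x)) x<bs

    -- One step of Fourier-Motzkin elimination: strict lower and upper bounds on a single unknown
    -- are compatible as soon as they are so in pairs. A value found for the shorter list of lower
    -- bounds is kept if it exceeds the new one; otherwise the new bound is the largest, and a value
    -- just above it serves.
    strictlyBetween : ∀ as bs → All (λ a → All (λ b → f a < g b) bs) as →
                      ∃[ x ] All (λ a → f a < x) as × All (λ b → x < g b) bs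
    strictlyBetween []       bs []            = let x , x<bs = strictLowerBound bs in x , [] , x<bs
    strictlyBetween (a ∷ as) bs (a<bs ∷ as<bs) with strictlyBetween as bs as<bs
    ... | x , as<x , x<bs with x ≤? f a
    ...   | no  x≰a = x , ≰⇒> x≰a ∷ as<x , x<bs
    ...   | yes x≤a = let y , a<y , y<bs = strictlyBelow (f a) bs a<bs in
                      y , a<y ∷ All.map (λ a′<x → <-≤-trans a′<x (≤-trans x≤a (proj₁ a<y))) as<x , y<bs

-- Inner products and Euclidean norms.

module InnerProduct (𝔽 : CompleteOrderedField) where
  open Euclidean 𝔽 using (Point; _+ᵛ_; _-ᵛ_; _*ᵛ_; _≋_; ‖_‖²; ‖_‖; ‖‖²-nonneg; dist; invert) public
  open OrderedField 𝔽 public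
  open import Algebra.Properties.Semiring.Sum semiring public
    using (sum-cong-≋; ∑-distrib-+; *-distribˡ-sum; sum-replicate-zero)

  infix 8 ⟨_,_⟩
  -- With equal arguments this is `‖_‖²` by definition, so bilinearity applies directly to squared
  -- norms.
  ⟨_,_⟩ : ∀ {d} → Point d → Point d → ℝ
  ⟨ u , x ⟩ = sum λ i → u i * x i

  module _ {d : ℕ} where
    ⟨⟩-cong : {u v x y : Point d} → u ≋ v → x ≋ y → ⟨ u , x ⟩ ≈ ⟨ v , y ⟩
    ⟨⟩-cong u≋v x≋y = sum-cong-≋ λ i → *-cong (u≋v i) (x≋y i)

    ⟨⟩-comm : (u x : Point d) → ⟨ u , x ⟩ ≈ ⟨ x , u ⟩
    ⟨⟩-comm u x = sum-cong-≋ λ i → *-comm (u i) (x i)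

    ⟨⟩-zeroʳ : (u x : Point d) → x ≋ (λ _ → 0#) → ⟨ u , x ⟩ ≈ 0#
    ⟨⟩-zeroʳ u x x≋0 = trans (sum-cong-≋ λ i → trans (*-congˡ (x≋0 i)) (zeroʳ (u i))) (sum-replicate-zero d)

    ⟨⟩-+ʳ : (u x y : Point d) → ⟨ u , x +ᵛ y ⟩ ≈ ⟨ u , x ⟩ + ⟨ u , y ⟩
    ⟨⟩-+ʳ u x y = trans (sum-cong-≋ λ i → distribˡ (u i) (x i) (y i)) (∑-distrib-+ (λ i → u i * x i) (λ i → u i * y i))

    ⟨⟩-*ʳ : ∀ c (u x : Point d) → ⟨ u , c *ᵛ x ⟩ ≈ c * ⟨ u , x ⟩
    ⟨⟩-*ʳ c u x = trans
      (sum-cong-≋ λ i → solve 3 (λ c u x → u :* (c :* x) := c :* (u :* x)) refl c (u i) (x i))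
      (sym (*-distribˡ-sum c (λ i → u i * x i)))

    ⟨⟩--ʳ : (u x y : Point d) → ⟨ u , x -ᵛ y ⟩ ≈ ⟨ u , x ⟩ -ʳ ⟨ u , y ⟩
    ⟨⟩--ʳ u x y = begin
      ⟨ u , x -ᵛ y ⟩                           ≈⟨ solve 2 (λ a b → a := a :+ b :- b) refl _ _ ⟩
      ⟨ u , x -ᵛ y ⟩ + ⟨ u , y ⟩ -ʳ ⟨ u , y ⟩  ≈⟨ +-congʳ (⟨⟩-+ʳ u (x -ᵛ y) y) ⟨
      ⟨ u , x -ᵛ y +ᵛ y ⟩ -ʳ ⟨ u , y ⟩         ≈⟨ +-congʳ (⟨⟩-cong {u = u} (λ _ → refl) x-y+y≋x) ⟩
      ⟨ u , x ⟩ -ʳ ⟨ u , y ⟩                   ∎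
      where
      x-y+y≋x : x -ᵛ y +ᵛ y ≋ x
      x-y+y≋x i = solve 2 (λ x y → x :- y :+ y := x) refl (x i) (y i)
      open import Relation.Binary.Reasoning.Setoid setoid

    ⟨⟩--ˡ : (u v x : Point d) → ⟨ u -ᵛ v , x ⟩ ≈ ⟨ u , x ⟩ -ʳ ⟨ v , x ⟩
    ⟨⟩--ˡ u v x = trans (⟨⟩-comm (u -ᵛ v) x) (trans (⟨⟩--ʳ x u v) (+-cong (⟨⟩-comm x u) (-‿cong (⟨⟩-comm x v))))

    ‖-‖² : (x y : Point d) → ‖ x -ᵛ y ‖² ≈ ‖ x ‖² -ʳ (⟨ y , x ⟩ + ⟨ y , x ⟩) + ‖ y ‖²
    ‖-‖² x y = begin
      ⟨ x -ᵛ y , x -ᵛ y ⟩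
        ≈⟨ trans (⟨⟩--ʳ (x -ᵛ y) x y) (+-cong (⟨⟩--ˡ x y x) (-‿cong (⟨⟩--ˡ x y y))) ⟩
      ‖ x ‖² -ʳ ⟨ y , x ⟩ -ʳ (⟨ x , y ⟩ -ʳ ‖ y ‖²)
        ≈⟨ +-congˡ (-‿cong (+-congʳ (⟨⟩-comm x y))) ⟩
      ‖ x ‖² -ʳ ⟨ y , x ⟩ -ʳ (⟨ y , x ⟩ -ʳ ‖ y ‖²)
        ≈⟨ solve 3 (λ a b c → a :- b :- (b :- c) := a :- (b :+ b) :+ c) refl _ _ _ ⟩
      ‖ x ‖² -ʳ (⟨ y , x ⟩ + ⟨ y , x ⟩) + ‖ y ‖²  ∎
      where open import Relation.Binary.Reasoning.Setoid setoid

    ‖*‖² : ∀ c (x : Point d) → ‖ c *ᵛ x ‖² ≈ c * c * ‖ x ‖²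
    ‖*‖² c x = trans (⟨⟩-*ʳ c (c *ᵛ x) x) (trans (*-congˡ (trans (⟨⟩-comm (c *ᵛ x) x) (⟨⟩-*ʳ c x x))) (sym (*-assoc c c _)))

  ‖‖²≈0⇒≋0 : ∀ {d} (x : Point d) → ‖ x ‖² ≈ 0# → x ≋ (λ _ → 0#)
  ‖‖²≈0⇒≋0 {suc d} x ‖x‖²≈0 = λ { zero → x*x≈0⇒x≈0 x₀²≈0 ; (suc i) → ‖‖²≈0⇒≋0 (λ i → x (suc i)) rest≈0 i }
    where
    x₀² = x zero * x zero
    rest = ‖ (λ i → x (suc i)) ‖²
    x₀²≈0 : x₀² ≈ 0#
    x₀²≈0 = antisym (≤-respʳ-≈ ‖x‖²≈0 (x≤x+y (‖‖²-nonneg (λ i → x (suc i))))) (x*x-nonneg (x zero))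
    rest≈0 : rest ≈ 0#
    rest≈0 = trans (sym (+-identityˡ rest)) (trans (+-congʳ (sym x₀²≈0)) ‖x‖²≈0)

  ≋-of-‖-‖² : ∀ {d} (x y : Point d) → ‖ x -ᵛ y ‖² ≈ 0# → x ≋ y
  ≋-of-‖-‖² x y ‖x-y‖²≈0 i = trans (solve 2 (λ x y → x := x :- y :+ y) refl (x i) (y i))
    (trans (+-congʳ (‖‖²≈0⇒≋0 (x -ᵛ y) ‖x-y‖²≈0 i)) (+-identityˡ (y i)))

  ‖-‖²-pos : ∀ {d} (x y : Point d) → ¬ (x ≋ y) → 0# < ‖ x -ᵛ y ‖²
  ‖-‖²-pos x y x≉y = ‖‖²-nonneg (x -ᵛ y) , λ 0≈ → x≉y (≋-of-‖-‖² x y (sym 0≈))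

  ‖‖-nonneg : ∀ {d} (x : Point d) → 0# ≤ ‖ x ‖
  ‖‖-nonneg x = proj₁ (proj₂ (squareRoot ‖ x ‖² (‖‖²-nonneg x)))

  ‖‖²-mono⁻ : ∀ {d} (x y : Point d) → ‖ x ‖ ≤ ‖ y ‖ → ‖ x ‖² ≤ ‖ y ‖²
  ‖‖²-mono⁻ x y x≤y =
    let s , 0≤s , s²≈ = squareRoot ‖ x ‖² (‖‖²-nonneg x)
        t , 0≤t , t²≈ = squareRoot ‖ y ‖² (‖‖²-nonneg y)
    in ≤-resp s²≈ t²≈ (*-mono-≤ 0≤s 0≤t x≤y x≤y)

  -- If the norms s and t satisfied t < s, then t * t ≤ s * t < s * s would contradict the order of
  -- the squares.
  ‖‖-mono : ∀ {d} (x y : Point d) → ‖ x ‖² ≤ ‖ y ‖² → ‖ x ‖ ≤ ‖ y ‖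
  ‖‖-mono x y x²≤y² with ‖ x ‖ ≤? ‖ y ‖
  ... | yes p = p
  ... | no  p =
    let s , 0≤s , s²≈ = squareRoot ‖ x ‖² (‖‖²-nonneg x)
        t , 0≤t , t²≈ = squareRoot ‖ y ‖² (‖‖²-nonneg y)
        t<s = ≰⇒> p
        0<s = ≤-<-trans 0≤t t<s
        st<ss = 0<-⇒< (<-resp refl (solve 2 (λ s t → s :* (s :- t) := s :* s :- s :* t) refl s t) (*-pos 0<s (<⇒0<- t<s)))
        t²<s² = ≤-<-trans (≤-respʳ-≈ (*-comm t s) (*-monoˡ-≤ 0≤t (proj₁ t<s))) st<ss
    in contradiction x²≤y² (<⇒≱ (<-resp t²≈ s²≈ t²<s²))

-- Gordan's theorem of the alternative.

module Gordan (𝔽 : CompleteOrderedField) where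
  open InnerProduct 𝔽
  open import Relation.Binary.Reasoning.Setoid setoid

  -- The scale factors are strictly positive, so 0 may be missing; its presence is the second
  -- alternative of `gordan`.
  record IsConvexCone {d} (K : Pred (Point d) 0ℓ) : Set where
    field
      resp  : ∀ {x y} → x ≋ y → K x → K y
      add   : ∀ {x y} → K x → K y → K (x +ᵛ y)
      scale : ∀ {c x} → 0# < c → K x → K (c *ᵛ x)

  -- The vectors of L, scaled by positive factors so that the first coordinate
  -- is 1, -1 or 0, and then stripped of it.
  record SignSplit {d} (K : Pred (Point (suc d)) 0ℓ) (L : List (Point (suc d))) : Set where
    field
      P N Z   : List (Point d)
      P⊆K     : All (λ p → K (1# Vector.∷ p)) P
      N⊆K     : All (λ n → K (- 1# Vector.∷ n)) N
      Z⊆K     : All (λ z → K (0# Vector.∷ z)) Z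
      recover : ∀ x u → All (λ p → - ⟨ u , p ⟩ < x) P → All (λ n → x < ⟨ u , n ⟩) N →
                All (λ z → 0# < ⟨ u , z ⟩) Z → All (λ a → 0# < ⟨ x Vector.∷ u , a ⟩) L

  module _ {d} {K : Pred (Point (suc d)) 0ℓ} (cone : IsConvexCone K) where
    open IsConvexCone cone

    -- Let a have first coordinate a₀ and tail t. Dividing x * a₀ + ⟨ u , t ⟩ > 0 by the absolute
    -- value of a₀ gives a lower bound on x if a₀ is positive and an upper bound if it is negative;
    -- for a₀ = 0 a condition on u alone remains.
    signSplit : ∀ {L} → All K L → SignSplit K L
    signSplit [] = record
      { P = [] ; N = [] ; Z = [] ; P⊆K = [] ; N⊆K = [] ; Z⊆K = [] ; recover = λ _ _ _ _ _ → [] }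
    signSplit {a ∷ _} (a∈K ∷ L⊆K) with signSplit L⊆K | 0# <? Vector.head a | Vector.head a <? 0#
    ... | s | yes 0<a₀ | _ = record
      { P = p ∷ P ; N = N ; Z = Z
      ; P⊆K = resp (λ { zero → trans (*-comm c a₀) (*⁻¹≈1 0<a₀) ; (suc i) → refl }) (scale (⁻¹-pos 0<a₀) a∈K) ∷ P⊆K
      ; N⊆K = N⊆K ; Z⊆K = Z⊆K
      ; recover = λ { x u (p<x ∷ P<x) x<N 0<Z →
          <-resp refl (eq x u) (*-pos 0<a₀ (<⇒0<- p<x)) ∷ recover x u P<x x<N 0<Z } }
      where
      open SignSplit s
      a₀ = Vector.head a
      c = a₀ ⁻¹
      p = c *ᵛ Vector.tail a
      eq : ∀ x u → a₀ * (x -ʳ - ⟨ u , p ⟩) ≈ x * a₀ + ⟨ u , Vector.tail a ⟩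
      eq x u = begin
        a₀ * (x -ʳ - ⟨ u , p ⟩)
          ≈⟨ *-congˡ (+-congˡ (-‿cong (-‿cong (⟨⟩-*ʳ c u (Vector.tail a))))) ⟩
        a₀ * (x -ʳ - (c * ⟨ u , Vector.tail a ⟩))
          ≈⟨ solve 4 (λ a x c t → a :* (x :- (:- (c :* t))) := x :* a :+ (a :* c) :* t) refl a₀ x c _ ⟩
        x * a₀ + (a₀ * c) * ⟨ u , Vector.tail a ⟩
          ≈⟨ +-congˡ (trans (*-congʳ (*⁻¹≈1 0<a₀)) (*-identityˡ _)) ⟩
        x * a₀ + ⟨ u , Vector.tail a ⟩  ∎
    ... | s | no _ | yes a₀<0 = record
      { P = P ; N = n ∷ N ; Z = Z
      ; P⊆K = P⊆K
      ; N⊆K = resp (λ { zero → trans (solve 2 (λ c a → c :* a := :- ((:- a) :* c)) refl c a₀) (-‿cong (*⁻¹≈1 0<b))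
                      ; (suc i) → refl }) (scale (⁻¹-pos 0<b) a∈K) ∷ N⊆K
      ; Z⊆K = Z⊆K
      ; recover = λ { x u P<x (x<n ∷ x<N) 0<Z →
          <-resp refl (eq x u) (*-pos 0<b (<⇒0<- x<n)) ∷ recover x u P<x x<N 0<Z } }
      where
      open SignSplit s
      a₀ = Vector.head a
      b = - a₀
      0<b : 0# < b
      0<b = <-resp refl (+-identityˡ b) (<⇒0<- a₀<0)
      c = b ⁻¹
      n = c *ᵛ Vector.tail a
      eq : ∀ x u → b * (⟨ u , n ⟩ -ʳ x) ≈ x * a₀ + ⟨ u , Vector.tail a ⟩
      eq x u = begin
        b * (⟨ u , n ⟩ -ʳ x)
          ≈⟨ *-congˡ (+-congʳ (⟨⟩-*ʳ c u (Vector.tail a))) ⟩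
        b * (c * ⟨ u , Vector.tail a ⟩ -ʳ x)
          ≈⟨ solve 4 (λ a x c t → (:- a) :* (c :* t :- x) := x :* a :+ ((:- a) :* c) :* t) refl a₀ x c _ ⟩
        x * a₀ + (b * c) * ⟨ u , Vector.tail a ⟩
          ≈⟨ +-congˡ (trans (*-congʳ (*⁻¹≈1 0<b)) (*-identityˡ _)) ⟩
        x * a₀ + ⟨ u , Vector.tail a ⟩  ∎
    ... | s | no 0≮a₀ | no a₀≮0 = record
      { P = P ; N = N ; Z = Vector.tail a ∷ Z
      ; P⊆K = P⊆K ; N⊆K = N⊆K
      ; Z⊆K = resp (λ { zero → a₀≈0 ; (suc i) → refl }) a∈K ∷ Z⊆K
      ; recover = λ { x u P<x x<N (0<z ∷ 0<Z) →
          <-resp refl (sym (trans (+-congʳ (trans (*-congˡ a₀≈0) (zeroʳ x))) (+-identityˡ _))) 0<z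
            ∷ recover x u P<x x<N 0<Z } }
      where
      open SignSplit s
      a₀≈0 : Vector.head a ≈ 0#
      a₀≈0 with total 0# (Vector.head a) | Vector.head a ≟ 0#
      ... | _        | yes p = p
      ... | inj₁ 0≤a | no ≉0 = contradiction (0≤a , λ e → ≉0 (sym e)) 0≮a₀
      ... | inj₂ a≤0 | no ≉0 = contradiction (a≤0 , ≉0) a₀≮0

  -- The first coordinate x of the sought functional is eliminated. The remaining conditions on u
  -- say that each lower bound on x is below each upper bound; they concern vectors in the slice of
  -- the cone where the first coordinate is 0, which is a convex cone in one dimension less.
  gordan : ∀ {d} {K : Pred (Point d) 0ℓ} → IsConvexCone K → ∀ {L} → All K L →
           (∃[ u ] All (λ a → 0# < ⟨ u , a ⟩) L) ⊎ K (λ _ → 0#)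
  gordan {zero}  cone []        = inj₁ ((λ ()) , [])
  -- In dimension 0 every vector is the zero vector.
  gordan {zero}  cone (a∈K ∷ _) = inj₂ (IsConvexCone.resp cone (λ ()) a∈K)
  gordan {suc d} {K} cone L⊆K with gordan cone₀ (All.++⁺ sums⊆K Z⊆K)
    where
    open IsConvexCone cone
    open SignSplit (signSplit cone L⊆K)

    cone₀ : IsConvexCone (λ y → K (0# Vector.∷ y))
    cone₀ = record
      { resp  = λ x≋y → resp λ { zero → refl ; (suc i) → x≋y i }
      ; add   = λ x∈K y∈K → resp (λ { zero → +-identityˡ 0# ; (suc i) → refl }) (add x∈K y∈K)
      ; scale = λ 0<c x∈K → resp (λ { zero → zeroʳ _ ; (suc i) → refl }) (scale 0<c x∈K)
      }

    -- The first coordinates 1 and -1 cancel, so each sum lies in the slice.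
    sums⊆K : All (λ y → K (0# Vector.∷ y)) (cartesianProductWith _+ᵛ_ P N)
    sums⊆K = All.cartesianProductWith⁺ (≡.setoid _) (≡.setoid _) _+ᵛ_ P N λ p∈P n∈N →
      resp (λ { zero → -‿inverseʳ 1# ; (suc i) → refl }) (add (All.lookup P⊆K p∈P) (All.lookup N⊆K n∈N))
  ... | inj₂ 0∈K = inj₂ (IsConvexCone.resp cone (λ { zero → refl ; (suc i) → refl }) 0∈K)
  ... | inj₁ (u , 0<u) = inj₁ (x Vector.∷ u , recover x u P<x x<N (All.++⁻ʳ _ 0<u))
    where
    open SignSplit (signSplit cone L⊆K)

    -- Positivity on p + n, rearranged into a lower bound below an upper bound.
    separated : All (λ p → All (λ n → - ⟨ u , p ⟩ < ⟨ u , n ⟩) N) P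
    separated = All.tabulate λ {p} p∈P → All.tabulate λ {n} n∈N → 0<-⇒< (<-resp refl
      (trans (⟨⟩-+ʳ u p n) (solve 2 (λ a b → a :+ b := b :- (:- a)) refl _ _))
      (All.lookup (All.++⁻ˡ _ 0<u) (∈-cartesianProductWith⁺ _+ᵛ_ p∈P n∈N)))

    between = strictlyBetween (λ p → - ⟨ u , p ⟩) (λ n → ⟨ u , n ⟩) P N separated
    x = proj₁ between
    P<x = proj₁ (proj₂ between)
    x<N = proj₂ (proj₂ between)

-- Convex hulls, and exposing hyperplanes at extreme points.

module ExtremePoints (𝔽 : CompleteOrderedField) where
  open Euclidean 𝔽 using (ConvexHull; Extreme)
  open InnerProduct 𝔽
  open Gordan 𝔽
  open import Relation.Binary.Reasoning.Setoid setoid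

  sum-++ : ∀ {m n} (xs : Vector ℝ m) (ys : Vector ℝ n) → sum (xs Vector.++ ys) ≈ sum xs + sum ys
  sum-++ {zero}  xs ys = sym (+-identityˡ _)
  sum-++ {suc m} xs ys = trans (+-congˡ (trans (sum-cong-≋ tail-++) (sum-++ (Vector.tail xs) ys))) (sym (+-assoc _ _ _))
    where
    tail-++ : ∀ i → (xs Vector.++ ys) (suc i) ≈ (Vector.tail xs Vector.++ ys) i
    tail-++ i with splitAt m i
    ... | inj₁ _ = refl
    ... | inj₂ _ = refl

  module _ {d} (S : Pred (Point d) 0ℓ) where

    hull-resp : ∀ {x y} → x ≋ y → ConvexHull S x → ConvexHull S y
    hull-resp x≋y (k , w , p , 0≤w , ∑w≈1 , p∈S , x≋) =
      k , w , p , 0≤w , ∑w≈1 , p∈S , λ i → trans (sym (x≋y i)) (x≋ i)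

    ⊆-hull : ∀ {x} → S x → ConvexHull S x
    ⊆-hull {x} x∈S = 1 , (λ _ → 1#) , (λ _ → x) , (λ _ → 0≤1) , +-identityʳ 1# , (λ _ → x∈S) ,
      λ j → sym (trans (+-identityʳ _) (*-identityˡ _))

    -- The two families of points are concatenated, with the weights of one multiplied by s and
    -- those of the other by t.
    hull-convex : ∀ {x y s t} → 0# ≤ s → 0# ≤ t → s + t ≈ 1# →
                  ConvexHull S x → ConvexHull S y → ConvexHull S (s *ᵛ x +ᵛ t *ᵛ y)
    hull-convex {x} {y} {s} {t} 0≤s 0≤t s+t≈1
                (k , w , p , 0≤w , ∑w≈1 , p∈S , x≋) (l , v , q , 0≤v , ∑v≈1 , q∈S , y≋) =
      k ℕ.+ l , sw Vector.++ tv , p Vector.++ q ,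
      VectorAll.++⁺ (0# ≤_) (λ i → *-nonneg 0≤s (0≤w i)) (λ i → *-nonneg 0≤t (0≤v i)) ,
      weights , VectorAll.++⁺ S p∈S q∈S , combination
      where
      sw = s *ᵛ w
      tv = t *ᵛ v

      weights : sum (sw Vector.++ tv) ≈ 1#
      weights = begin
        sum (sw Vector.++ tv)  ≈⟨ sum-++ sw tv ⟩
        sum sw + sum tv        ≈⟨ +-cong (*-distribˡ-sum s w) (*-distribˡ-sum t v) ⟨
        s * sum w + t * sum v  ≈⟨ +-cong (trans (*-congˡ ∑w≈1) (*-identityʳ s)) (trans (*-congˡ ∑v≈1) (*-identityʳ t)) ⟩
        s + t                  ≈⟨ s+t≈1 ⟩
        1#                     ∎

      combination : ∀ j → s * x j + t * y j ≈ sum λ i → (sw Vector.++ tv) i * (p Vector.++ q) i j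
      combination j = begin
        s * x j + t * y j
          ≈⟨ +-cong (*-congˡ (x≋ j)) (*-congˡ (y≋ j)) ⟩
        s * sum (λ i → w i * p i j) + t * sum (λ i → v i * q i j)
          ≈⟨ +-cong (*-distribˡ-sum s λ i → w i * p i j) (*-distribˡ-sum t λ i → v i * q i j) ⟩
        sum (λ i → s * (w i * p i j)) + sum (λ i → t * (v i * q i j))
          ≈⟨ +-cong (sum-cong-≋ λ i → *-assoc s (w i) (p i j)) (sum-cong-≋ λ i → *-assoc t (v i) (q i j)) ⟨
        sum wp + sum vq
          ≈⟨ sum-++ wp vq ⟨
        sum (wp Vector.++ vq)
          ≈⟨ sum-cong-≋ products ⟩
        sum (λ i → (sw Vector.++ tv) i * (p Vector.++ q) i j)  ∎
        where
        wp = λ i → sw i * p i j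
        vq = λ i → tv i * q i j
        products : ∀ i → (wp Vector.++ vq) i ≈ (sw Vector.++ tv) i * (p Vector.++ q) i j
        products i with splitAt k i
        ... | inj₁ _ = refl
        ... | inj₂ _ = refl

  module _ {d} (S : Pred (Point d) 0ℓ) (v : Point d) where

    -- The cone generated by the differences v - y for y in the hull. The sign is such that a
    -- functional positive on it is largest at v.
    Feasible : Pred (Point d) 0ℓ
    Feasible h = ∃[ c ] 0# < c × ConvexHull S (v -ᵛ c *ᵛ h)

    feasible-cone : IsConvexCone Feasible
    feasible-cone = record { resp = resp′ ; add = add′ ; scale = scale′ }
      where
      resp′ : ∀ {x y} → x ≋ y → Feasible x → Feasible y
      resp′ x≋y (c , 0<c , x∈) = c , 0<c , hull-resp S (λ i → +-congˡ (-‿cong (*-congˡ (x≋y i)))) x∈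

      add′ : ∀ {x y} → Feasible x → Feasible y → Feasible (x +ᵛ y)
      -- The weights b / (c + b) and c / (c + b) give x and y the same coefficient c * b / (c + b).
      add′ {x} {y} (c , 0<c , x∈) (b , 0<b , y∈) =
        c * b * e , *-pos (*-pos 0<c 0<b) 0<e , hull-resp S eq
          (hull-convex S (proj₁ (*-pos 0<b 0<e)) (proj₁ (*-pos 0<c 0<e)) s+t≈1 x∈ y∈)
        where
        e = (c + b) ⁻¹
        0<e : 0# < e
        0<e = ⁻¹-pos (+-pos 0<c 0<b)
        s+t≈1 : b * e + c * e ≈ 1#
        s+t≈1 = trans (solve 3 (λ b c e → b :* e :+ c :* e := (c :+ b) :* e) refl b c e) (*⁻¹≈1 (+-pos 0<c 0<b))
        eq : ∀ i → b * e * (v i -ʳ c * x i) + c * e * (v i -ʳ b * y i) ≈ v i -ʳ c * b * e * (x i + y i)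
        eq i = begin
          b * e * (v i -ʳ c * x i) + c * e * (v i -ʳ b * y i)
            ≈⟨ solve 6 (λ b c e v x y → b :* e :* (v :- c :* x) :+ c :* e :* (v :- b :* y) :=
                 (b :* e :+ c :* e) :* v :- c :* b :* e :* (x :+ y)) refl b c e (v i) (x i) (y i) ⟩
          (b * e + c * e) * v i -ʳ c * b * e * (x i + y i)
            ≈⟨ +-congʳ (trans (*-congʳ s+t≈1) (*-identityˡ (v i))) ⟩
          v i -ʳ c * b * e * (x i + y i)  ∎

      scale′ : ∀ {k x} → 0# < k → Feasible x → Feasible (k *ᵛ x)
      scale′ {k} {x} 0<k (c , 0<c , x∈) = c * k ⁻¹ , *-pos 0<c (⁻¹-pos 0<k) , hull-resp S
        (λ i → +-congˡ (-‿cong (sym (trans (sym (*-assoc _ k (x i))) (*-congʳ (/-cancel c k (pos⇒≉0 0<k))))))) x∈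

    -- Remembering a nonzero summand keeps 0 out of this cone at an extreme point.
    NonzeroFeasible : Pred (Point d) 0ℓ
    NonzeroFeasible h = ∃[ g ] ¬ (g ≋ (λ _ → 0#)) × Feasible g × Feasible (h -ᵛ g)

    nonzeroFeasible-cone : IsConvexCone NonzeroFeasible
    nonzeroFeasible-cone = record
      { resp  = λ x≋y (g , g≉0 , g∈F , x-g∈F) → g , g≉0 , g∈F , resp (λ i → +-congʳ (x≋y i)) x-g∈F
      ; add   = λ {x} {y} (g , g≉0 , g∈F , x-g∈F) (f , _ , f∈F , y-f∈F) → g , g≉0 , g∈F ,
          resp (λ i → solve 4 (λ x g y f → (x :- g) :+ (f :+ (y :- f)) := x :+ y :- g) refl (x i) (g i) (y i) (f i))
            (add x-g∈F (add f∈F y-f∈F))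
      ; scale = λ {c} {x} 0<c (g , g≉0 , g∈F , x-g∈F) → c *ᵛ g ,
          (λ cg≈0 → g≉0 λ i → *-cancel-0 0<c (cg≈0 i)) , scale 0<c g∈F ,
          resp (λ i → solve 3 (λ c x g → c :* (x :- g) := c :* x :- c :* g) refl c (x i) (g i)) (scale 0<c x-g∈F)
      }
      where
      open IsConvexCone feasible-cone

    module _ (v-extreme : Extreme S v) where

      -- Otherwise both g and its negative are feasible, and v lies strictly between v - c g and v +
      -- b g. Extremality collapses this segment to v, which forces g to be 0.
      nonzeroFeasible-pointed : ¬ NonzeroFeasible (λ _ → 0#)
      nonzeroFeasible-pointed (g , g≉0 , (c , 0<c , x∈) , (b , 0<b , y∈)) = g≉0 λ i →
        *-cancel-0 0<c (begin
          c * g i                  ≈⟨ solve 2 (λ v h → h := v :- (v :- h)) refl (v i) (c * g i) ⟩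
          v i -ʳ (v i -ʳ c * g i)  ≈⟨ +-congˡ (-‿cong (x≋v i)) ⟩
          v i -ʳ v i               ≈⟨ -‿inverseʳ (v i) ⟩
          0#                       ∎)
        where
        e = (c + b) ⁻¹
        -- The position of v on the segment, c / (c + b).
        t = c * e
        0<e : 0# < e
        0<e = ⁻¹-pos (+-pos 0<c 0<b)
        [c+b]e≈1 : (c + b) * e ≈ 1#
        [c+b]e≈1 = *⁻¹≈1 (+-pos 0<c 0<b)

        t<1 : t < 1#
        t<1 = 0<-⇒< (<-resp refl (begin
          b * e                  ≈⟨ solve 3 (λ b c e → b :* e := (c :+ b) :* e :- c :* e) refl b c e ⟩
          (c + b) * e -ʳ c * e   ≈⟨ +-congʳ [c+b]e≈1 ⟩
          1# -ʳ t                ∎) (*-pos 0<b 0<e))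

        between : ∀ i → v i ≈ (1# -ʳ t) * (v i -ʳ c * g i) + t * (v i -ʳ b * (0# -ʳ g i))
        between i = begin
          v i
            ≈⟨ solve 3 (λ v c g → v := v :- c :* g :+ c :* g :* con 1ℤ) refl (v i) c (g i) ⟩
          v i -ʳ c * g i + c * g i * 1#
            ≈⟨ +-congˡ (*-congˡ [c+b]e≈1) ⟨
          v i -ʳ c * g i + c * g i * ((c + b) * e)
            ≈⟨ solve 5 (λ v c g b e → v :- c :* g :+ c :* g :* ((c :+ b) :* e) :=
                 (con 1ℤ :- c :* e) :* (v :- c :* g) :+ c :* e :* (v :- b :* (con 0ℤ :- g))) refl (v i) c (g i) b e ⟩
          (1# -ʳ t) * (v i -ʳ c * g i) + t * (v i -ʳ b * (0# -ʳ g i))  ∎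

        x≋v : v -ᵛ c *ᵛ g ≋ v
        x≋v = proj₁ (proj₂ v-extreme _ _ t x∈ y∈ (*-pos 0<c 0<e) t<1 between)

      -- The differences v - y lie in a convex cone without 0, so Gordan's alternative leaves only
      -- the functional.
      extreme⇒exposed : ∀ {ys} → All (λ y → S y × ¬ (y ≋ v)) ys → ∃[ u ] All (λ y → 0# < ⟨ u , v -ᵛ y ⟩) ys
      extreme⇒exposed ys⊆S with gordan nonzeroFeasible-cone (All.map⁺ (All.map direction ys⊆S))
        where
        direction : ∀ {y} → S y × ¬ (y ≋ v) → NonzeroFeasible (v -ᵛ y)
        -- The nonzero summand is v - y itself; the remainder 0 is feasible because v is in the
        -- hull.
        direction {y} (y∈S , y≉v) = v -ᵛ y , v-y≉0 ,
          (1# , 0<1 , hull-resp S (λ i → solve 2 (λ v y → y := v :- con 1ℤ :* (v :- y)) refl (v i) (y i)) (⊆-hull S y∈S)) ,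
          (1# , 0<1 , hull-resp S (λ i → solve 2 (λ v y → v := v :- con 1ℤ :* (v :- y :- (v :- y))) refl (v i) (y i))
            (proj₁ v-extreme))
          where
          v-y≉0 : ¬ (v -ᵛ y ≋ λ _ → 0#)
          v-y≉0 v-y≈0 = y≉v λ i → begin
            y i                  ≈⟨ solve 2 (λ v y → y := v :- (v :- y)) refl (v i) (y i) ⟩
            v i -ʳ (v i -ʳ y i)  ≈⟨ +-congˡ (-‿cong (v-y≈0 i)) ⟩
            v i -ʳ 0#            ≈⟨ solve 1 (λ v → v :- con 0ℤ := v) refl (v i) ⟩
            v i                  ∎
      ... | inj₁ (u , 0<u) = u , All.map⁻ 0<u
      ... | inj₂ 0∈K = contradiction 0∈K nonzeroFeasible-pointed

-- Minima over finite index sets.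

module FiniteMinima (𝔽 : CompleteOrderedField) where
  open OrderedField 𝔽
  open DecTotalOrder decTotalOrder using (totalOrder)

  minimizer : ∀ {n} {P : Pred (Fin n) 0ℓ} → Decidable P → (f : Fin n → ℝ) → ∃ P →
              ∃[ i ] P i × (∀ j → P j → f i ≤ f j)
  -- `argmin` may return its default value, so this must satisfy P too.
  minimizer {n} {P} P? f (i₀ , i₀∈P) = argmin totalOrder f i₀ candidates ,
    argmin-all totalOrder f i₀∈P (All.all-filter P? (allFin n)) ,
    λ j j∈P → All.lookup (f[argmin]≤f[xs] totalOrder {f = f} i₀ candidates) (∈-filter⁺ P? (∈-allFin j) j∈P)
    where candidates = filter P? (allFin n)

  positiveLowerBound : ∀ {n} {P : Pred (Fin n) 0ℓ} → Decidable P → (f : Fin n → ℝ) → (∀ i → P i → 0# < f i) →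
                       ∃[ κ ] 0# < κ × (∀ i → P i → κ ≤ f i)
  positiveLowerBound P? f 0<f with Fin.any? P?
  -- With nothing to bound, any positive number does.
  ... | no  ∄P = 1# , 0<1 , λ i i∈P → contradiction (i , i∈P) ∄P
  ... | yes ∃P = let i , i∈P , min = minimizer P? f ∃P in f i , 0<f i i∈P , min

x∉p∖x : ∀ {n} (p : Subset n) x → x ∉ p ∖ x
x∉p∖x (_ ∷ᵛ p) (suc x) (there x∈) = x∉p∖x p x x∈

-- From a ball to a query point that shows relevance.

module Relevance {𝔽 : CompleteOrderedField} {d n : ℕ} {C : Set}
                 (_≟ᶜ_ : DecidableEquality C) (D : TrainingSet 𝔽 d n C) where
  open InnerProduct 𝔽
  open FiniteMinima 𝔽
  open TrainingSet D
  open NearestNeighbor D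
  open import Relation.Binary.Reasoning.Setoid setoid

  -- The ball with center point j + h / 2 and point j on its boundary contains
  -- point r, but no further point of a class other than that of r.
  record Witness (r j : Fin n) : Set where
    field
      bichromatic : class j ≢ class r
      h           : Point d
      near        : ‖ point r -ᵛ point j ‖² ≤ ⟨ h , point r -ᵛ point j ⟩
      far         : ∀ s → s ≢ j → class s ≢ class r → ⟨ h , point s -ᵛ point j ⟩ < ‖ point s -ᵛ point j ‖²

  separation : ∀ {i j} → i ≢ j → 0# < ‖ point i -ᵛ point j ‖²
  separation i≢j = ‖-‖²-pos _ _ λ pᵢ≋pⱼ → i≢j (distinct pᵢ≋pⱼ)

  module _ (X : Subset n) {r j : Fin n} (r∈X : r ∈ X) (j∈X : j ∈ X) (w : Witness r j) where
    open Witness w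

    private
      -- Shrink the ball of the witness towards point j, dividing its radius by a positive t. A
      -- point i other than j lies in the resulting closed ball exactly if t ≤ M i.
      A B M : Fin n → ℝ
      A i = ‖ point i -ᵛ point j ‖²
      B i = ⟨ h , point i -ᵛ point j ⟩
      M i = B i * A i ⁻¹

      Other : Pred (Fin n) 0ℓ
      Other i = i ∈ X × i ≢ j

      other? : Decidable Other
      other? i = (i ∈? X) ×-dec ¬? (i Fin.≟ j)

      r≢j : r ≢ j
      r≢j r≡j = bichromatic (≡.cong class (≡.sym r≡j))

      MA≈B : ∀ {i} → i ≢ j → M i * A i ≈ B i
      MA≈B i≢j = /-cancel _ _ (pos⇒≉0 (separation i≢j))

      -- Minimizing `- M` finds a point of X that is among the last to leave the shrinking ball.
      largest = minimizer other? (λ i → - M i) (r , r∈X , r≢j)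
      s = proj₁ largest
      s≢j = proj₂ (proj₁ (proj₂ largest))

      M≤Mₛ : ∀ {i} → Other i → M i ≤ M s
      M≤Mₛ {i} i-other = 0≤-⇒≤ (≤-respʳ-≈ (solve 2 (λ a b → :- a :- (:- b) := b :- a) refl (M i) (M s))
        (≤⇒0≤- (proj₂ (proj₂ largest) i i-other)))

      -- The original ball, with t = 1, contains point r, so `M r` is already at least 1.
      1≤Mₛ : 1# ≤ M s
      1≤Mₛ = ≤-trans (≤-resp (trans (*-comm _ _) (*⁻¹≈1 0<A)) (*-comm _ _) (*-monoˡ-≤ (proj₁ (⁻¹-pos 0<A)) near))
        (M≤Mₛ (r∈X , r≢j))
        where 0<A = separation r≢j

      -- The bound `κ` is the margin by which the points of classes other than that of r, apart from
      -- j, stay outside the original ball, measured by their power A i - B i.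
      foreign = positiveLowerBound (λ i → ¬? (i Fin.≟ j) ×-dec ¬? (class i ≟ᶜ class r)) (λ i → A i -ʳ B i)
        λ i (i≢j , ≢r) → <⇒0<- (far i i≢j ≢r)
      κ = proj₁ foreign

      -- The distances from q are ordered as the values of φ below.  With τ equal
      -- to M s, the point s would be as near to q as point j, and no point nearer.
      η τ σ : ℝ
      η = κ * A s ⁻¹
      τ = M s + η
      σ = (τ + τ) ⁻¹

      ηA≈κ : η * A s ≈ κ
      ηA≈κ = /-cancel _ _ (pos⇒≉0 (separation s≢j))

      0<η : 0# < η
      0<η = *-pos (proj₁ (proj₂ foreign)) (⁻¹-pos (separation s≢j))

      0<2τ : 0# < τ + τ
      0<2τ = +-pos 0<τ 0<τ
        where 0<τ = +-nonneg-pos (≤-trans 0≤1 1≤Mₛ) 0<η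

      0<2σ : 0# < σ + σ
      0<2σ = +-pos (⁻¹-pos 0<2τ) (⁻¹-pos 0<2τ)

      q : Point d
      q = point j +ᵛ σ *ᵛ h

      φ : Fin n → ℝ
      φ i = τ * A i -ʳ B i

      -- The square is expanded about point j. Since (τ + τ) * σ = 1, the term A i also takes the
      -- factor σ + σ.
      dist²-φ : ∀ i → ‖ q -ᵛ point i ‖² ≈ ‖ q -ᵛ point j ‖² + (σ + σ) * φ i
      dist²-φ i = begin
        ‖ q -ᵛ point i ‖²
          ≈⟨ ⟨⟩-cong shift shift ⟩
        ‖ σ *ᵛ h -ᵛ (point i -ᵛ point j) ‖²
          ≈⟨ ‖-‖² (σ *ᵛ h) (point i -ᵛ point j) ⟩
        ‖ σ *ᵛ h ‖² -ʳ (⟨ point i -ᵛ point j , σ *ᵛ h ⟩ + ⟨ point i -ᵛ point j , σ *ᵛ h ⟩) + A i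
          ≈⟨ +-cong (+-cong (⟨⟩-cong shift₀ shift₀) (-‿cong (+-cong inner inner)))
               (trans (sym (*-identityˡ (A i))) (*-congʳ (sym (*⁻¹≈1 0<2τ)))) ⟩
        ‖ q -ᵛ point j ‖² -ʳ (σ * B i + σ * B i) + (τ + τ) * σ * A i
          ≈⟨ solve 5 (λ Q σ B τ A → Q :- (σ :* B :+ σ :* B) :+ (τ :+ τ) :* σ :* A := Q :+ (σ :+ σ) :* (τ :* A :- B))
               refl ‖ q -ᵛ point j ‖² σ (B i) τ (A i) ⟩
        ‖ q -ᵛ point j ‖² + (σ + σ) * φ i  ∎
        where
        shift : q -ᵛ point i ≋ σ *ᵛ h -ᵛ (point i -ᵛ point j)
        shift k = solve 3 (λ p g x → p :+ g :- x := g :- (x :- p)) refl (point j k) (σ * h k) (point i k)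
        shift₀ : σ *ᵛ h ≋ q -ᵛ point j
        shift₀ k = solve 2 (λ p g → g := p :+ g :- p) refl (point j k) (σ * h k)
        inner : ⟨ point i -ᵛ point j , σ *ᵛ h ⟩ ≈ σ * B i
        inner = trans (⟨⟩-*ʳ σ _ h) (*-congˡ (⟨⟩-comm _ h))

      closer : ∀ {i k} → φ i ≤ φ k → dist q (point i) ≤ dist q (point k)
      closer {i} {k} φᵢ≤φₖ = ‖‖-mono (q -ᵛ point i) (q -ᵛ point k)
        (≤-resp (sym (dist²-φ i)) (sym (dist²-φ k)) (+-monoʳ-≤ _ (*-monoˡ-≤ (proj₁ 0<2σ) φᵢ≤φₖ)))

      closer⁻ : ∀ {i k} → dist q (point i) ≤ dist q (point k) → φ i ≤ φ k
      closer⁻ {i} {k} i≤k = ≮⇒≥ λ φₖ<φᵢ → <⇒≱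
        (<-resp (sym (dist²-φ k)) (sym (dist²-φ i)) (0<-⇒< (<-resp refl
          (solve 4 (λ Q σ a b → σ :* (b :- a) := Q :+ σ :* b :- (Q :+ σ :* a)) refl ‖ q -ᵛ point j ‖² (σ + σ) (φ k) (φ i))
          (*-pos 0<2σ (<⇒0<- φₖ<φᵢ)))))
        (‖‖²-mono⁻ (q -ᵛ point i) (q -ᵛ point k) i≤k)

      -- φ i splits into η * A i, which is positive, and (M s - M i) * A i, which is nonnegative by
      -- the choice of s.
      φ-pos : ∀ {i} → Other i → 0# < φ i
      φ-pos {i} i-other@(_ , i≢j) = <-resp refl (begin
        η * A i + (M s -ʳ M i) * A i
          ≈⟨ solve 4 (λ η A M m → η :* A :+ (M :- m) :* A := (M :+ η) :* A :- m :* A) refl η (A i) (M s) (M i) ⟩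
        τ * A i -ʳ M i * A i  ≈⟨ +-congˡ (-‿cong (MA≈B i≢j)) ⟩
        φ i                   ∎)
        (+-pos-nonneg (*-pos 0<η (separation i≢j)) (*-nonneg (≤⇒0≤- (M≤Mₛ i-other)) (proj₁ (separation i≢j))))

      φₛ≈κ : φ s ≈ κ
      φₛ≈κ = begin
        τ * A s -ʳ B s          ≈⟨ +-congˡ (-‿cong (MA≈B s≢j)) ⟨
        τ * A s -ʳ M s * A s    ≈⟨ solve 3 (λ M η A → (M :+ η) :* A :- M :* A := η :* A) refl (M s) η (A s) ⟩
        η * A s                 ≈⟨ ηA≈κ ⟩
        κ                       ∎

      -- The value of η was chosen to make φ s equal to κ. For i of a class other than that of r, φ
      -- i exceeds A i - B i ≥ κ by (τ - 1) * A i, and τ > 1.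
      φₛ<φ : ∀ {i} → i ≢ j → class i ≢ class r → φ s < φ i
      φₛ<φ {i} i≢j ≢r = <-resp (sym φₛ≈κ) refl (≤-<-trans (proj₂ (proj₂ foreign) i (i≢j , ≢r)) (0<-⇒< (<-resp refl
        (solve 4 (λ η A M B → η :* A :+ (M :- con 1ℤ) :* A := (M :+ η) :* A :- B :- (A :- B)) refl η (A i) (M s) (B i))
        (+-pos-nonneg (*-pos 0<η (separation i≢j)) (*-nonneg (≤⇒0≤- 1≤Mₛ) (proj₁ (separation i≢j)))))))

      φⱼ≈0 : φ j ≈ 0#
      φⱼ≈0 = begin
        τ * A j -ʳ B j
          ≈⟨ +-cong (*-congˡ (⟨⟩-zeroʳ o o o≋0)) (-‿cong (⟨⟩-zeroʳ h o o≋0)) ⟩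
        τ * 0# -ʳ 0#
          ≈⟨ solve 1 (λ τ → τ :* con 0ℤ :- con 0ℤ := con 0ℤ) refl τ ⟩
        0#  ∎
        where
        o = point j -ᵛ point j
        o≋0 : o ≋ (λ _ → 0#)
        o≋0 k = -‿inverseʳ (point j k)

    -- The query point q has j as its only nearest point in X, as φ vanishes at j and is positive
    -- elsewhere. Without j, all points of classes other than that of r lose to s.
    witness⇒relevant : Relevant X j
    witness⇒relevant = j∈X , q , class j , class r ,
      ((j , j∈X , j-nearest) , only-j) ,
      ((k , x∈p∧x≢y⇒x∈p-y (proj₁ k-other) (proj₂ k-other) , λ i i∈ → closer (k-min i (∈X∖j i∈))) , only-r) ,
      bichromatic
      where
      ∈X∖j : ∀ {i} → i ∈ X ∖ j → Other i
      ∈X∖j i∈ = p─q⊆p X _ i∈ , λ { ≡.refl → x∉p∖x X j i∈ }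

      j-nearest : ∀ i → i ∈ X → dist q (point j) ≤ dist q (point i)
      j-nearest i i∈X = by-cases (i Fin.≟ j)
        where
        by-cases : Dec (i ≡ j) → dist q (point j) ≤ dist q (point i)
        by-cases (yes ≡.refl) = ≤-refl
        by-cases (no  i≢j)    = closer (≤-respˡ-≈ (sym φⱼ≈0) (proj₁ (φ-pos (i∈X , i≢j))))

      only-j : ∀ i → IsNearest X q i → class i ≡ class j
      only-j i (i∈X , i≤) = ≡.cong class (decidable-stable (i Fin.≟ j) λ i≢j → 
        <⇒≱ (φ-pos (i∈X , i≢j)) (≤-respʳ-≈ φⱼ≈0 (closer⁻ (i≤ j j∈X))))

      -- The point nearest to q after the removal of j need not be s; s only bounds its distance.
      second = minimizer other? φ (r , r∈X , r≢j)
      k = proj₁ second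
      k-other = proj₁ (proj₂ second)
      k-min = proj₂ (proj₂ second)

      only-r : ∀ i → IsNearest (X ∖ j) q i → class i ≡ class r
      only-r i (i∈ , i≤) = decidable-stable (class i ≟ᶜ class r) λ ≢r →
        <⇒≱ (φₛ<φ (proj₂ (∈X∖j i∈)) ≢r) (closer⁻ (i≤ s (x∈p∧x≢y⇒x∈p-y (proj₁ (proj₁ (proj₂ largest))) s≢j)))

-- Balls from extreme points of the inverted set.

module InvertedExtreme {𝔽 : CompleteOrderedField} {d n : ℕ} {C : Set}
                 (_≟ᶜ_ : DecidableEquality C) (D : TrainingSet 𝔽 d n C) where
  open InnerProduct 𝔽
  open ExtremePoints 𝔽
  open Euclidean 𝔽 using (Extreme)
  open TrainingSet D
  open Algorithm D using (itself; other; Inverted)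
  open Relevance _≟ᶜ_ D
  open import Relation.Binary.Reasoning.Setoid setoid

  module _ {r j : Fin n} (j≢r : class j ≢ class r)
           (extreme : Extreme (Inverted r) (invert (point r) (point j))) where

    private
      e y : Fin n → Point d
      e i = point i -ᵛ point r
      y i = invert (point r) (point i)

      k : Fin n → ℝ
      k i = ‖ e i ‖² ⁻¹

      foreign⇒≢ : ∀ {i} → class i ≢ class r → i ≢ r
      foreign⇒≢ ≢r i≡r = ≢r (≡.cong class i≡r)

      0<k : ∀ {i} → i ≢ r → 0# < k i
      0<k i≢r = ⁻¹-pos (separation i≢r)

      k‖e‖²≈1 : ∀ {i} → i ≢ r → k i * ‖ e i ‖² ≈ 1#
      k‖e‖²≈1 i≢r = trans (*-comm _ _) (*⁻¹≈1 (separation i≢r))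

      -- The squared distance from r to the image is the reciprocal of that to the original, so the
      -- image determines the factor k i.
      ‖ke‖²≈k : ∀ {i} → i ≢ r → ‖ k i *ᵛ e i ‖² ≈ k i
      ‖ke‖²≈k {i} i≢r = trans (‖*‖² (k i) (e i))
        (trans (*-assoc _ _ _) (trans (*-congˡ (k‖e‖²≈1 i≢r)) (*-identityʳ (k i))))

      y≋⇒ke≋ : ∀ {i} → y i ≋ y j → k i *ᵛ e i ≋ k j *ᵛ e j
      y≋⇒ke≋ yᵢ≋yⱼ l = trans (solve 2 (λ p x → x := p :+ x :- p) refl (point r l) _)
        (trans (+-congʳ (yᵢ≋yⱼ l)) (solve 2 (λ p x → p :+ x :- p := x) refl (point r l) _))

      r≉y : ¬ (point r ≋ y j)
      r≉y r≋y = pos⇒≉0 (0<k (foreign⇒≢ j≢r)) (trans (sym (‖ke‖²≈k (foreign⇒≢ j≢r))) (⟨⟩-zeroʳ _ _ ke≋0))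
        where
        ke≋0 : k j *ᵛ e j ≋ (λ _ → 0#)
        ke≋0 l = begin
          k j * e j l                           ≈⟨ solve 2 (λ p x → x := p :+ x :- p) refl (point r l) _ ⟩
          point r l + k j * e j l -ʳ point r l  ≈⟨ +-congʳ (r≋y l) ⟨
          point r l -ʳ point r l                ≈⟨ -‿inverseʳ _ ⟩
          0#                                    ∎

      -- Equal images have equal distances from r, hence equal factors, which can be divided out.
      invert-injective : ∀ {i} → i ≢ r → y i ≋ y j → i ≡ j
      invert-injective {i} i≢r yᵢ≋yⱼ = distinct λ l → begin
        point i l            ≈⟨ solve 2 (λ p x → x := p :+ (x :- p)) refl (point r l) (point i l) ⟩
        point r l + e i l    ≈⟨ +-congˡ (e≋ l) ⟩
        point r l + e j l    ≈⟨ solve 2 (λ p x → p :+ (x :- p) := x) refl (point r l) (point j l) ⟩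
        point j l            ∎
        where
        ke≋ = y≋⇒ke≋ yᵢ≋yⱼ
        kᵢ≈kⱼ : k i ≈ k j
        kᵢ≈kⱼ = trans (sym (‖ke‖²≈k i≢r)) (trans (⟨⟩-cong ke≋ ke≋) (‖ke‖²≈k (foreign⇒≢ j≢r)))
        e≋ : e i ≋ e j
        e≋ l = begin
          e i l                        ≈⟨ *-identityˡ _ ⟨
          1# * e i l                   ≈⟨ *-congʳ (k‖e‖²≈1 i≢r) ⟨
          k i * ‖ e i ‖² * e i l       ≈⟨ solve 3 (λ k n e → k :* n :* e := n :* (k :* e)) refl (k i) ‖ e i ‖² (e i l) ⟩
          ‖ e i ‖² * (k i * e i l)     ≈⟨ *-congˡ (trans (ke≋ l) (*-congʳ (sym kᵢ≈kⱼ))) ⟩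
          ‖ e i ‖² * (k i * e j l)     ≈⟨ solve 3 (λ k n e → n :* (k :* e) := k :* n :* e) refl (k i) ‖ e i ‖² (e j l) ⟩
          k i * ‖ e i ‖² * e j l       ≈⟨ *-congʳ (k‖e‖²≈1 i≢r) ⟩
          1# * e j l                   ≈⟨ *-identityˡ _ ⟩
          e j l                        ∎

      Foreign : Pred (Fin n) 0ℓ
      Foreign i = i ≢ j × class i ≢ class r

      foreign? : Decidable Foreign
      foreign? i = ¬? (i Fin.≟ j) ×-dec ¬? (class i ≟ᶜ class r)

      -- The list holds the whole inverted set apart from `y j`. Its head, point r, yields β > 0;
      -- the other entries bound their functional values by β.
      exposed = extreme⇒exposed (Inverted r) (y j) extreme {point r ∷ map y (filter foreign? (allFin n))}
        (((r , point r , itself , λ _ → refl) , r≉y) ∷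
         All.map⁺ (All.map (λ {i} (i≢j , i≢r) → (i , y i , other i≢r , λ _ → refl) ,
                                              λ yᵢ≋yⱼ → i≢j (invert-injective (foreign⇒≢ i≢r) yᵢ≋yⱼ))
                           (All.all-filter foreign? (allFin n))))

      u = proj₁ exposed

      -- The hyperplane through `y j` has the equation ⟨ u , x - r ⟩ = β. Its inverse is the sphere
      -- ‖ x - r ‖² = c ⟨ u , x - r ⟩, which passes through r.
      β c : ℝ
      β = k j * ⟨ u , e j ⟩
      c = β ⁻¹

      ⟨u,y⟩ : ∀ i → ⟨ u , y i ⟩ ≈ ⟨ u , point r ⟩ + k i * ⟨ u , e i ⟩
      ⟨u,y⟩ i = trans (⟨⟩-+ʳ u (point r) (k i *ᵛ e i)) (+-congˡ (⟨⟩-*ʳ (k i) u (e i)))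

      0<β : 0# < β
      0<β = <-resp refl (begin
        ⟨ u , y j -ᵛ point r ⟩                     ≈⟨ ⟨⟩--ʳ u (y j) (point r) ⟩
        ⟨ u , y j ⟩ -ʳ ⟨ u , point r ⟩             ≈⟨ +-congʳ (⟨u,y⟩ j) ⟩
        ⟨ u , point r ⟩ + β -ʳ ⟨ u , point r ⟩     ≈⟨ solve 2 (λ p x → p :+ x :- p := x) refl _ β ⟩
        β                                          ∎)
        (All.head (proj₂ exposed))

      k⟨u,e⟩<β : ∀ {i} → Foreign i → k i * ⟨ u , e i ⟩ < β
      k⟨u,e⟩<β {i} foreign = 0<-⇒< (<-resp refl (begin
        ⟨ u , y j -ᵛ y i ⟩
          ≈⟨ trans (⟨⟩--ʳ u (y j) (y i)) (+-cong (⟨u,y⟩ j) (-‿cong (⟨u,y⟩ i))) ⟩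
        ⟨ u , point r ⟩ + β -ʳ (⟨ u , point r ⟩ + k i * ⟨ u , e i ⟩)
          ≈⟨ solve 3 (λ p x y → p :+ x :- (p :+ y) := x :- y) refl _ β (k i * ⟨ u , e i ⟩) ⟩
        β -ʳ k i * ⟨ u , e i ⟩  ∎)
        (All.lookup (All.map⁻ (All.tail (proj₂ exposed))) (∈-filter⁺ foreign? (∈-allFin i) foreign)))

      -- This puts point j on the sphere, as `y j` is on the hyperplane.
      c⟨u,eⱼ⟩≈‖eⱼ‖² : c * ⟨ u , e j ⟩ ≈ ‖ e j ‖²
      c⟨u,eⱼ⟩≈‖eⱼ‖² = begin
        c * ⟨ u , e j ⟩                      ≈⟨ *-identityˡ _ ⟨
        1# * (c * ⟨ u , e j ⟩)               ≈⟨ *-congʳ (k‖e‖²≈1 (foreign⇒≢ j≢r)) ⟨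
        k j * ‖ e j ‖² * (c * ⟨ u , e j ⟩)   ≈⟨ solve 4 (λ k n c x → k :* n :* (c :* x) := n :* (k :* x :* c))
                                                  refl (k j) ‖ e j ‖² c _ ⟩
        ‖ e j ‖² * (β * c)                   ≈⟨ trans (*-congˡ (*⁻¹≈1 0<β)) (*-identityʳ _) ⟩
        ‖ e j ‖²                             ∎

      -- Twice the vector from point j to the center of the ball whose sphere is
      -- the inverse of the hyperplane ⟨u , x⟩ = ⟨u , y j⟩.
      h : Point d
      h = c *ᵛ u -ᵛ (e j +ᵛ e j)

      ⟨h,⟩ : ∀ x → ⟨ h , x ⟩ ≈ c * ⟨ u , x ⟩ -ʳ (⟨ e j , x ⟩ + ⟨ e j , x ⟩)
      ⟨h,⟩ x = begin
        ⟨ h , x ⟩                              ≈⟨ ⟨⟩-comm h x ⟩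
        ⟨ x , c *ᵛ u -ᵛ (e j +ᵛ e j) ⟩         ≈⟨ ⟨⟩--ʳ x (c *ᵛ u) (e j +ᵛ e j) ⟩
        ⟨ x , c *ᵛ u ⟩ -ʳ ⟨ x , e j +ᵛ e j ⟩   ≈⟨ +-cong (⟨⟩-*ʳ c x u) (-‿cong (⟨⟩-+ʳ x (e j) (e j))) ⟩
        c * ⟨ x , u ⟩ -ʳ (⟨ x , e j ⟩ + ⟨ x , e j ⟩)
          ≈⟨ +-cong (*-congˡ (⟨⟩-comm x u)) (-‿cong (+-cong (⟨⟩-comm x (e j)) (⟨⟩-comm x (e j)))) ⟩
        c * ⟨ u , x ⟩ -ʳ (⟨ e j , x ⟩ + ⟨ e j , x ⟩)  ∎

      -- Both sides are the power of point i with respect to the sphere, computed from its point j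
      -- on the left and from its point r on the right.
      power : ∀ i → ‖ point i -ᵛ point j ‖² -ʳ ⟨ h , point i -ᵛ point j ⟩ ≈ ‖ e i ‖² -ʳ c * ⟨ u , e i ⟩
      power i = begin
        ‖ point i -ᵛ point j ‖² -ʳ ⟨ h , point i -ᵛ point j ⟩
          ≈⟨ +-cong (⟨⟩-cong shift shift) (-‿cong (⟨⟩-cong {u = h} (λ _ → refl) shift)) ⟩
        ‖ e i -ᵛ e j ‖² -ʳ ⟨ h , e i -ᵛ e j ⟩
          ≈⟨ +-cong (‖-‖² (e i) (e j)) (-‿cong (⟨⟩--ʳ h (e i) (e j))) ⟩
        ‖ e i ‖² -ʳ (⟨ e j , e i ⟩ + ⟨ e j , e i ⟩) + ‖ e j ‖² -ʳ (⟨ h , e i ⟩ -ʳ ⟨ h , e j ⟩)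
          ≈⟨ +-congˡ (-‿cong (+-cong (⟨h,⟩ (e i)) (-‿cong (trans (⟨h,⟩ (e j)) (+-congʳ c⟨u,eⱼ⟩≈‖eⱼ‖²))))) ⟩
        ‖ e i ‖² -ʳ (⟨ e j , e i ⟩ + ⟨ e j , e i ⟩) + ‖ e j ‖²
          -ʳ (c * ⟨ u , e i ⟩ -ʳ (⟨ e j , e i ⟩ + ⟨ e j , e i ⟩) -ʳ (‖ e j ‖² -ʳ (‖ e j ‖² + ‖ e j ‖²)))
          ≈⟨ solve 4 (λ a b f x → a :- (b :+ b) :+ f :- (x :- (b :+ b) :- (f :- (f :+ f))) := a :- x)
               refl ‖ e i ‖² ⟨ e j , e i ⟩ ‖ e j ‖² (c * ⟨ u , e i ⟩) ⟩
        ‖ e i ‖² -ʳ c * ⟨ u , e i ⟩  ∎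
        where
        shift : point i -ᵛ point j ≋ e i -ᵛ e j
        shift l = solve 3 (λ i j r → i :- j := i :- r :- (j :- r)) refl (point i l) (point j l) (point r l)

      -- Point r lies on the sphere, so its power is 0.
      near : ‖ point r -ᵛ point j ‖² ≤ ⟨ h , point r -ᵛ point j ⟩
      near = ≤-reflexive (begin
        ‖ point r -ᵛ point j ‖²
          ≈⟨ solve 2 (λ a b → a := a :- b :+ b) refl _ ⟨ h , point r -ᵛ point j ⟩ ⟩
        ‖ point r -ᵛ point j ‖² -ʳ ⟨ h , point r -ᵛ point j ⟩ + ⟨ h , point r -ᵛ point j ⟩
          ≈⟨ +-congʳ (power r) ⟩
        ‖ e r ‖² -ʳ c * ⟨ u , e r ⟩ + ⟨ h , point r -ᵛ point j ⟩
          ≈⟨ +-congʳ (+-cong (⟨⟩-zeroʳ (e r) (e r) eᵣ≋0) (-‿cong (*-congˡ (⟨⟩-zeroʳ u (e r) eᵣ≋0)))) ⟩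
        0# -ʳ c * 0# + ⟨ h , point r -ᵛ point j ⟩
          ≈⟨ solve 2 (λ c b → con 0ℤ :- c :* con 0ℤ :+ b := b) refl c _ ⟩
        ⟨ h , point r -ᵛ point j ⟩  ∎)
        where
        eᵣ≋0 : e r ≋ (λ _ → 0#)
        eᵣ≋0 l = -‿inverseʳ (point r l)

      -- The power of point i is a positive multiple of its image's distance below the hyperplane.
      far : ∀ i → i ≢ j → class i ≢ class r → ⟨ h , point i -ᵛ point j ⟩ < ‖ point i -ᵛ point j ‖²
      far i i≢j i≢r = 0<-⇒< (<-resp refl (begin
        ‖ e i ‖² * c * (β -ʳ k i * ⟨ u , e i ⟩)
          ≈⟨ solve 5 (λ n c β k x → n :* c :* (β :- k :* x) := n :* (β :* c) :- c :* (k :* n :* x))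
               refl ‖ e i ‖² c β (k i) _ ⟩
        ‖ e i ‖² * (β * c) -ʳ c * (k i * ‖ e i ‖² * ⟨ u , e i ⟩)
          ≈⟨ +-cong (trans (*-congˡ (*⁻¹≈1 0<β)) (*-identityʳ _))
               (-‿cong (*-congˡ (trans (*-congʳ (k‖e‖²≈1 (foreign⇒≢ i≢r))) (*-identityˡ _)))) ⟩
        ‖ e i ‖² -ʳ c * ⟨ u , e i ⟩
          ≈⟨ power i ⟨
        ‖ point i -ᵛ point j ‖² -ʳ ⟨ h , point i -ᵛ point j ⟩  ∎)
        (*-pos (*-pos (separation (foreign⇒≢ i≢r)) (⁻¹-pos 0<β)) (<⇒0<- (k⟨u,e⟩<β (i≢j , i≢r)))))

    extreme⇒witness : Witness r j
    extreme⇒witness = record { bichromatic = j≢r ; h = h ; near = near ; far = far }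

-- Deleting and adding edges, spanning trees, and exchange.

module Graphs {n : ℕ} where
  open Graph

  -- With `isYes`, `Edge` unfolds to the type on which `toWitness` and `fromWitness` act.
  fromDecidable : (R : Rel (Fin n) 0ℓ) → Decidable₂ R → Symmetric R → (∀ i → ¬ R i i) → Graph n
  fromDecidable R R? sym irrefl = record
    { adjacent    = λ i j → isYes (R? i j)
    ; symmetric   = λ i j → ≡.trans (isYes≗does (R? i j))
        (≡.trans (does-⇔ (mk⇔ sym sym) (R? i j) (R? j i)) (≡.sym (isYes≗does (R? j i))))
    ; irreflexive = λ i → ≡.trans (isYes≗does (R? i i)) (dec-false (R? i i) (irrefl i))
    }

  infix 4 _⊆ᴳ_
  _⊆ᴳ_ : Rel (Graph n) 0ℓ
  G ⊆ᴳ H = ∀ i j → Edge G i j → Edge H i j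

  edge? : (G : Graph n) → Decidable₂ (Edge G)
  edge? G i j = T? (adjacent G i j)

  edge-sym : ∀ (G : Graph n) i j → Edge G i j → Edge G j i
  edge-sym G i j = ≡.subst T (symmetric G i j)

  edge-irrefl : ∀ (G : Graph n) i → ¬ Edge G i i
  edge-irrefl G i = ≡.subst T (irreflexive G i)

  Joins : Fin n → Fin n → Rel (Fin n) 0ℓ
  Joins p q i j = (i ≡ p × j ≡ q) ⊎ (i ≡ q × j ≡ p)

  joins? : ∀ p q → Decidable₂ (Joins p q)
  joins? p q i j = (i Fin.≟ p ×-dec j Fin.≟ q) ⊎-dec (i Fin.≟ q ×-dec j Fin.≟ p)

  joins-sym : ∀ {p q} → Symmetric (Joins p q)
  joins-sym (inj₁ (i≡p , j≡q)) = inj₂ (j≡q , i≡p)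
  joins-sym (inj₂ (i≡q , j≡p)) = inj₁ (j≡p , i≡q)

  joins-irrefl : ∀ {p q} → p ≢ q → ∀ i → ¬ Joins p q i i
  joins-irrefl p≢q i (inj₁ (≡.refl , p≡q)) = p≢q p≡q
  joins-irrefl p≢q i (inj₂ (≡.refl , q≡p)) = p≢q (≡.sym q≡p)

  singleEdge : ∀ {p q} → p ≢ q → Graph n
  singleEdge {p} {q} p≢q = fromDecidable (Joins p q) (joins? p q) joins-sym (joins-irrefl p≢q)

  Kept : Graph n → Fin n → Fin n → Rel (Fin n) 0ℓ
  Kept G p q i j = Edge G i j × ¬ Joins p q i j

  kept? : ∀ (G : Graph n) p q → Decidable₂ (Kept G p q)
  kept? G p q i j = edge? G i j ×-dec ¬? (joins? p q i j)

  delete : Graph n → Fin n → Fin n → Graph n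
  delete G p q = fromDecidable (Kept G p q) (kept? G p q)
    (λ {i} {j} (e , ¬pq) → edge-sym G i j e , λ pq → ¬pq (joins-sym pq)) (λ i (e , _) → edge-irrefl G i e)

  infixl 6 _∪ᴳ_
  _∪ᴳ_ : Graph n → Graph n → Graph n
  G ∪ᴳ H = fromDecidable (λ i j → Edge G i j ⊎ Edge H i j) (λ i j → edge? G i j ⊎-dec edge? H i j)
    (λ {i} {j} → Sum.map (edge-sym G i j) (edge-sym H i j)) (λ i → Sum.[ edge-irrefl G i , edge-irrefl H i ])

  singleEdge⁺ : ∀ {p q} (p≢q : p ≢ q) → Edge (singleEdge p≢q) p q
  singleEdge⁺ {p} {q} _ = fromWitness {a? = joins? p q p q} (inj₁ (≡.refl , ≡.refl))

  singleEdge⁻ : ∀ {p q} (p≢q : p ≢ q) {i j} → Edge (singleEdge p≢q) i j → Joins p q i j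
  singleEdge⁻ {p} {q} _ {i} {j} = toWitness {a? = joins? p q i j}

  delete⁺ : ∀ (G : Graph n) p q {i j} → Edge G i j → ¬ Joins p q i j → Edge (delete G p q) i j
  delete⁺ G p q {i} {j} e ¬pq = fromWitness {a? = kept? G p q i j} (e , ¬pq)

  delete⁻ : ∀ (G : Graph n) p q {i j} → Edge (delete G p q) i j → Kept G p q i j
  delete⁻ G p q {i} {j} = toWitness {a? = kept? G p q i j}

  ∪ᴳ⁺ : ∀ (G H : Graph n) {i j} → Edge G i j ⊎ Edge H i j → Edge (G ∪ᴳ H) i j
  ∪ᴳ⁺ G H {i} {j} = fromWitness {a? = edge? G i j ⊎-dec edge? H i j}

  ∪ᴳ⁻ : ∀ (G H : Graph n) {i j} → Edge (G ∪ᴳ H) i j → Edge G i j ⊎ Edge H i j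
  ∪ᴳ⁻ G H {i} {j} = toWitness {a? = edge? G i j ⊎-dec edge? H i j}

  delete-mono : ∀ {G H : Graph n} p q → G ⊆ᴳ H → delete G p q ⊆ᴳ delete H p q
  delete-mono {G} {H} p q G⊆H i j e = let e′ , ¬pq = delete⁻ G p q e in delete⁺ H p q (G⊆H i j e′) ¬pq

  reverse : ∀ (G : Graph n) {i j} → Star (Edge G) i j → Star (Edge G) j i
  reverse G = Star.reverse (λ {i} {j} → edge-sym G i j)

  -- Along a path of G, every use of the edge pq is replaced by the given path, reversed where
  -- necessary.
  reconnect : ∀ (G H : Graph n) {p q} → Connected G → delete G p q ⊆ᴳ H → Star (Edge H) p q → Connected H
  reconnect G H {p} {q} G-connected ⊆H path i j = kleisliStar id detour (G-connected i j)
    where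
    detour : ∀ {i j} → Edge G i j → Star (Edge H) i j
    detour {i} {j} e with joins? p q i j
    ... | yes (inj₁ (≡.refl , ≡.refl)) = path
    ... | yes (inj₂ (≡.refl , ≡.refl)) = reverse H path
    ... | no  ¬pq                      = return (⊆H i j (delete⁺ G p q e ¬pq))

  -- The rest of the cycle leads from v back to u. As its vertices are distinct, none of its edges
  -- is uv.
  cycle⇒bypass : ∀ (G : Graph n) {u v w vs} → IsCycle G u v w vs → Star (Edge (delete G u v)) u v
  cycle⇒bypass G {u} {v} {w} {vs} ((u≢v ∷ u≢w ∷ u≢vs) ∷ (v≢w ∷ v≢vs) ∷ _ , _ ∷ vw ∷ linked) =
    reverse (delete G u v) (delete⁺ G u v vw
        Sum.[ (λ (v≡u , _) → u≢v (≡.sym v≡u)) , (λ (_ , w≡u) → u≢w (≡.sym w≡u)) ]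
      ◅ around w vs ((u≢w , v≢w) ∷ All.zip (u≢vs , v≢vs)) linked)
    where
    around : ∀ x xs → All (λ z → u ≢ z × v ≢ z) (x ∷ xs) → Linked (Edge G) ((x ∷ xs) ∷ʳ u) →
             Star (Edge (delete G u v)) x u
    around x []       ((u≢x , v≢x) ∷ _)  (xu ∷ _) = return (delete⁺ G u v xu
      Sum.[ (λ (x≡u , _) → u≢x (≡.sym x≡u)) , (λ (x≡v , _) → v≢x (≡.sym x≡v)) ])
    around x (y ∷ ys) ((u≢x , v≢x) ∷ ≢s) (xy ∷ linked) = delete⁺ G u v xy
      Sum.[ (λ (x≡u , _) → u≢x (≡.sym x≡u)) , (λ (x≡v , _) → v≢x (≡.sym x≡v)) ] ◅ around y ys ≢s linked

  -- Vacuous at pairs that are not edges, so that `prune` can run through all pairs of vertices.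
  Bridge : Graph n → Fin n × Fin n → Set
  Bridge G (u , v) = Edge G u v → ¬ Connected (delete G u v)

  -- The listed edges are deleted one by one while the graph stays connected. An edge once found to
  -- be a bridge remains one, since later deletions only remove further connections. Connectedness
  -- is decided under a double negation, which is enough for refuting an inequality of weights.
  prune : ∀ uvs (G : Graph n) → Connected G → ¬ ¬ (∃[ H ] H ⊆ᴳ G × Connected H × All (Bridge H) uvs)
  prune []              G G-connected ¬∃ = ¬∃ (G , (λ _ _ → id) , G-connected , [])
  prune ((u , v) ∷ uvs) G G-connected ¬∃ = ¬¬-excluded-middle {A = Edge G u v × Connected (delete G u v)} λ
    { (yes (_ , connected)) → prune uvs (delete G u v) connected λ (H , H⊆ , H-connected , bridges) →
        ¬∃ (H , (λ i j → proj₁ ∘ delete⁻ G u v ∘ H⊆ i j) , H-connected ,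
            (λ e → contradiction (inj₁ (≡.refl , ≡.refl)) (proj₂ (delete⁻ G u v (H⊆ u v e)))) ∷ bridges)
    ; (no ¬removable) → prune uvs G G-connected λ (H , H⊆ , H-connected , bridges) →
        ¬∃ (H , H⊆ , H-connected ,
            (λ e connected → ¬removable (H⊆ u v e , λ i j →
              Star.map (delete-mono {H} {G} u v H⊆ _ _) (connected i j))) ∷ bridges)
    }

  -- In a pruned graph all edges are bridges, whereas the first edge of a cycle is bypassed by the
  -- rest of it.
  spanningTree : ∀ (G : Graph n) → Connected G → ¬ ¬ (∃[ H ] H ⊆ᴳ G × IsTree H)
  spanningTree G G-connected = ¬¬-map
    (λ (H , H⊆G , H-connected , bridges) → H , H⊆G , H-connected , λ u v w vs cycle →
      All.lookup bridges (∈-cartesianProduct⁺ (∈-allFin u) (∈-allFin v)) (firstEdge {H} (proj₂ cycle))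
        (reconnect H (delete H u v) H-connected (λ _ _ → id) (cycle⇒bypass H cycle)))
    (prune (cartesianProduct (allFin n) (allFin n)) G G-connected)
    where
    firstEdge : ∀ {H : Graph n} {u v xs} → Linked (Edge H) (u ∷ v ∷ xs) → Edge H u v
    firstEdge (e ∷ _) = e

  -- Follow the path from s up to its first use of the edge pq; there it stands at p or at q.
  delete-split : ∀ (G : Graph n) {p q s} → Star (Edge G) s p →
                 Star (Edge (delete G p q)) s p ⊎ Star (Edge (delete G p q)) s q
  delete-split G ε = inj₁ ε
  delete-split G {p} {q} {s} (_◅_ {j = t} e path) with joins? p q s t
  ... | yes (inj₁ (≡.refl , _)) = inj₁ ε
  ... | yes (inj₂ (≡.refl , _)) = inj₂ ε
  ... | no  ¬pq = Sum.map (delete⁺ G p q e ¬pq ◅_) (delete⁺ G p q e ¬pq ◅_) (delete-split G path)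

  -- The walk from p to s followed by the new edge sq replaces the deleted edge pq.
  exchange-connected : ∀ (G : Graph n) {p q s} (s≢q : s ≢ q) → Connected G → Star (Edge (delete G p q)) s p →
                       Connected (delete G p q ∪ᴳ singleEdge s≢q)
  exchange-connected G {p} {q} s≢q G-connected path = reconnect G (G′ ∪ᴳ S) G-connected (λ _ _ → ∪ᴳ⁺ G′ S ∘ inj₁)
    (Star.map (∪ᴳ⁺ G′ S ∘ inj₁) (reverse G′ path) ◅◅ return (∪ᴳ⁺ G′ S (inj₂ (singleEdge⁺ s≢q))))
    where
    G′ = delete G p q
    S  = singleEdge s≢q

-- Weights of graphs, and the exchange argument for minimum spanning trees.

module SpanningTreeExchange {𝔽 : CompleteOrderedField} {d n : ℕ} {C : Set} (D : TrainingSet 𝔽 d n C) where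
  open InnerProduct 𝔽
  open TrainingSet D
  open Algorithm D using (weight; IsMinimumSpanningTree)
  open Graph
  open Graphs {n}
  open import Relation.Binary.Reasoning.Setoid setoid

  sum-mono : ∀ {m} {f g : Fin m → ℝ} → (∀ i → f i ≤ g i) → sum f ≤ sum g
  sum-mono {zero}  f≤g = ≤-refl
  sum-mono {suc m} f≤g = +-mono-≤ (f≤g zero) (sum-mono (f≤g ∘ suc))

  sum-concentrated : ∀ {m} {f : Fin m → ℝ} a → (∀ i → i ≢ a → f i ≈ 0#) → sum f ≈ f a
  sum-concentrated {suc m} zero    f≈0 = trans
    (+-congˡ (trans (sum-cong-≋ λ i → f≈0 (suc i) λ ()) (sum-replicate-zero m))) (+-identityʳ _)
  sum-concentrated {suc m} (suc a) f≈0 = trans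
    (+-cong (f≈0 zero λ ()) (sum-concentrated a λ i i≢a → f≈0 (suc i) (i≢a ∘ Fin.suc-injective))) (+-identityˡ _)

  module _ {x : ℝ} where
    if-true : ∀ b → T b → (if b then x else 0#) ≈ x
    if-true true _ = refl

    if-false : ∀ b → ¬ T b → (if b then x else 0#) ≈ 0#
    if-false true  ¬b = contradiction _ ¬b
    if-false false _  = refl

    module _ (0≤x : 0# ≤ x) where
      if-nonneg : ∀ b → 0# ≤ (if b then x else 0#)
      if-nonneg true  = 0≤x
      if-nonneg false = ≤-refl

      -- The termwise form of the subadditivity of `weight` under unions.
      if-cover : ∀ b b₁ b₂ → (T b → T b₁ ⊎ T b₂) →
                 (if b then x else 0#) ≤ (if b₁ then x else 0#) + (if b₂ then x else 0#)
      if-cover false b₁    b₂    _ = +-nonneg (if-nonneg b₁) (if-nonneg b₂)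
      if-cover true  true  b₂    _ = x≤x+y (if-nonneg b₂)
      if-cover true  false true  _ = ≤-reflexive (sym (+-identityˡ x))
      if-cover true  false false b→ = contradiction (b→ _) Sum.[ id , id ]

      -- The termwise form of the superadditivity of `weight` on disjoint sets of edges.
      if-disjoint : ∀ b b₁ b₂ → (T b₁ → T b) → (T b₂ → T b) → (T b₁ → ¬ T b₂) →
                    (if b₁ then x else 0#) + (if b₂ then x else 0#) ≤ (if b then x else 0#)
      if-disjoint b     false false _   _   _  = ≤-respˡ-≈ (sym (+-identityʳ 0#)) (if-nonneg b)
      if-disjoint true  true  false _   _   _  = ≤-reflexive (+-identityʳ x)
      if-disjoint true  false true  _   _   _  = ≤-reflexive (+-identityˡ x)
      if-disjoint b     true  true  _   _   #  = contradiction _ (# _)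
      if-disjoint false true  false b₁→ _   _  = contradiction (b₁→ _) id
      if-disjoint false false true  _   b₂→ _  = contradiction (b₂→ _) id

  counted : Graph n → Fin n → Fin n → Bool
  counted G i j = does (i Fin.<? j) ∧ adjacent G i j

  counted⁻ : ∀ G i j → T (counted G i j) → i Fin.< j × Edge G i j
  counted⁻ G i j t = let i<ᵇj , e = Equivalence.to Bool.T-∧ t in ℕ.<ᵇ⇒< (Fin.toℕ i) (Fin.toℕ j) i<ᵇj , e

  counted⁺ : ∀ G i j → i Fin.< j → Edge G i j → T (counted G i j)
  counted⁺ G i j i<j e = Equivalence.from Bool.T-∧ (ℕ.<⇒<ᵇ i<j , e)

  ℓ : Fin n → Fin n → ℝ
  ℓ i j = dist (point i) (point j)

  0≤ℓ : ∀ i j → 0# ≤ ℓ i j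
  0≤ℓ i j = ‖‖-nonneg (point i -ᵛ point j)

  term : Graph n → Fin n → Fin n → ℝ
  term G i j = if counted G i j then ℓ i j else 0#

  ∑∑-distrib-+ : (f g : Fin n → Fin n → ℝ) →
    (sum λ i → sum λ j → f i j + g i j) ≈ (sum λ i → sum (f i)) + (sum λ i → sum (g i))
  ∑∑-distrib-+ f g = trans (sum-cong-≋ λ i → ∑-distrib-+ (f i) (g i)) (∑-distrib-+ (λ i → sum (f i)) (λ i → sum (g i)))

  weight-∪ : ∀ G H → weight (G ∪ᴳ H) ≤ weight G + weight H
  weight-∪ G H = ≤-respʳ-≈ (∑∑-distrib-+ (term G) (term H)) (sum-mono λ i → sum-mono λ j →
    if-cover (0≤ℓ i j) (counted (G ∪ᴳ H) i j) (counted G i j) (counted H i j) λ t →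
      let i<j , e = counted⁻ (G ∪ᴳ H) i j t in Sum.map (counted⁺ G i j i<j) (counted⁺ H i j i<j) (∪ᴳ⁻ G H e))

  weight-disjoint : ∀ F G H → G ⊆ᴳ F → H ⊆ᴳ F → (∀ i j → Edge G i j → ¬ Edge H i j) → weight G + weight H ≤ weight F
  weight-disjoint F G H G⊆F H⊆F disjoint = ≤-respˡ-≈ (∑∑-distrib-+ (term G) (term H)) (sum-mono λ i → sum-mono λ j →
    if-disjoint (0≤ℓ i j) (counted F i j) (counted G i j) (counted H i j)
      (λ t → let i<j , e = counted⁻ G i j t in counted⁺ F i j i<j (G⊆F i j e))
      (λ t → let i<j , e = counted⁻ H i j t in counted⁺ F i j i<j (H⊆F i j e))
      (λ t t′ → disjoint i j (proj₂ (counted⁻ G i j t)) (proj₂ (counted⁻ H i j t′))))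

  weight-mono : ∀ G H → G ⊆ᴳ H → weight G ≤ weight H
  weight-mono G H G⊆H = sum-mono λ i → sum-mono λ j → ≤-respʳ-≈ (+-identityʳ _)
    -- The second part of the cover is empty.
    (if-cover (0≤ℓ i j) (counted G i j) (counted H i j) false λ t →
      let i<j , e = counted⁻ G i j t in inj₁ (counted⁺ H i j i<j (G⊆H i j e)))

  weight-concentrated : ∀ G a b → a Fin.< b → Edge G a b → (∀ i j → i Fin.< j → Edge G i j → i ≡ a × j ≡ b) →
                        weight G ≈ ℓ a b
  weight-concentrated G a b a<b e only = begin
    weight G
      ≈⟨ sum-concentrated a (λ i i≢a → trans
           (sum-cong-≋ λ j → if-false (counted G i j) λ t → i≢a (proj₁ (only′ i j t))) (sum-replicate-zero n)) ⟩
    sum (term G a)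
      ≈⟨ sum-concentrated b (λ j j≢b → if-false (counted G a j) λ t → j≢b (proj₂ (only′ a j t))) ⟩
    term G a b
      ≈⟨ if-true (counted G a b) (counted⁺ G a b a<b e) ⟩
    ℓ a b  ∎
    where
    only′ : ∀ i j → T (counted G i j) → i ≡ a × j ≡ b
    only′ i j t = uncurry (only i j) (counted⁻ G i j t)

  ℓ-comm : ∀ i j → ℓ i j ≈ ℓ j i
  ℓ-comm i j = antisym (‖‖-mono (point i -ᵛ point j) (point j -ᵛ point i) (≤-reflexive eq))
                       (‖‖-mono (point j -ᵛ point i) (point i -ᵛ point j) (≤-reflexive (sym eq)))
    where
    eq : ‖ point i -ᵛ point j ‖² ≈ ‖ point j -ᵛ point i ‖²
    eq = sum-cong-≋ λ k → solve 2 (λ x y → (x :- y) :* (x :- y) := (y :- x) :* (y :- x)) refl (point i k) (point j k)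

  -- The sum counts an edge from its smaller index, which may be p or q; the symmetry of distance
  -- settles the second case.
  weight-singleEdge : ∀ {p q} (p≢q : p ≢ q) → weight (singleEdge p≢q) ≈ ℓ p q
  weight-singleEdge {p} {q} p≢q with Fin.<-cmp p q
  ... | tri≈ _ p≡q _ = contradiction p≡q p≢q
  ... | tri< p<q _ _ = weight-concentrated S p q p<q (singleEdge⁺ p≢q) λ i j i<j e → Sum.[ id ,
          (λ { (≡.refl , ≡.refl) → contradiction i<j (Fin.<-asym p<q) }) ] (singleEdge⁻ p≢q e)
    where S = singleEdge p≢q
  ... | tri> _ _ q<p = trans (weight-concentrated S q p q<p (edge-sym S p q (singleEdge⁺ p≢q)) λ i j i<j e → Sum.[
          (λ { (≡.refl , ≡.refl) → contradiction i<j (Fin.<-asym q<p) }) , id ] (singleEdge⁻ p≢q e)) (ℓ-comm q p)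
    where S = singleEdge p≢q

  module _ {G : Graph n} (mst : IsMinimumSpanningTree G) where

    -- Replacing pq by the shorter sq gives a connected graph lighter than the minimum. Passing to a
    -- spanning tree inside it spares a proof that it is acyclic.
    no-exchange : ∀ {p q s} → Edge G p q → (s≢q : s ≢ q) → Star (Edge (delete G p q)) s p → ¬ (ℓ s q < ℓ p q)
    no-exchange {p} {q} {s} e s≢q path sq<pq =
      spanningTree H (exchange-connected G s≢q (proj₁ (proj₁ mst)) path) λ (F , F⊆H , F-tree) →
        <⇒≱ H<G (≤-trans (proj₂ mst F F-tree) (weight-mono F H F⊆H))
      where
      p≢q : p ≢ q
      p≢q ≡.refl = edge-irrefl G p e
      G′ = delete G p q
      H = G′ ∪ᴳ singleEdge s≢q

      pq⊆G : singleEdge p≢q ⊆ᴳ G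
      pq⊆G i j ij with singleEdge⁻ p≢q ij
      ... | inj₁ (≡.refl , ≡.refl) = e
      ... | inj₂ (≡.refl , ≡.refl) = edge-sym G p q e

      H<G : weight H < weight G
      H<G = ≤-<-trans (weight-∪ G′ (singleEdge s≢q)) (<-≤-trans
        (0<-⇒< (<-resp refl (trans
          (solve 3 (λ w x y → y :- x := w :+ y :- (w :+ x)) refl (weight G′) (ℓ s q) (ℓ p q))
          (+-cong (+-congˡ (sym (weight-singleEdge p≢q))) (-‿cong (+-congˡ (sym (weight-singleEdge s≢q))))))
          (<⇒0<- sq<pq)))
        (weight-disjoint G G′ (singleEdge p≢q) (λ i j ij → proj₁ (delete⁻ G p q ij)) pq⊆G
          λ i j kept pq → proj₂ (delete⁻ G p q kept) (singleEdge⁻ p≢q pq)))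

    delete-comm : ∀ p q → delete G p q ⊆ᴳ delete G q p
    delete-comm p q i j kept = let e , ¬pq = delete⁻ G p q kept in delete⁺ G q p e (¬pq ∘ Sum.swap)

    -- Without the edge pq, s is still connected to p or to q. An edge from s to the other end would
    -- then be a cheaper replacement.
    mst-lune-empty : ∀ {p q s} → Edge G p q → s ≢ p → s ≢ q → ℓ s p < ℓ p q → ¬ (ℓ s q < ℓ p q)
    mst-lune-empty {p} {q} {s} e s≢p s≢q sp<pq sq<pq with delete-split G {p} {q} (proj₁ (proj₁ mst) s p)
    ... | inj₁ path = no-exchange e s≢q path sq<pq
    ... | inj₂ path = no-exchange (edge-sym G p q e) s≢p (Star.map (delete-comm p q _ _) path)
                      (<-resp refl (ℓ-comm p q) sp<pq)

-- Witnesses for all points found by the algorithm.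

module Correctness {𝔽 : CompleteOrderedField} {d n : ℕ} {C : Set}
                   (_≟ᶜ_ : DecidableEquality C) (D : TrainingSet 𝔽 d n C) where
  open InnerProduct 𝔽
  open TrainingSet D
  open Algorithm D
  open Graph using (Edge)
  open Graphs {n} using (edge-sym)
  open Relevance _≟ᶜ_ D
  open InvertedExtreme _≟ᶜ_ D
  open SpanningTreeExchange D

  dist-mono-< : ∀ {a b c e : Fin n} → ‖ point a -ᵛ point b ‖² < ‖ point c -ᵛ point e ‖² → ℓ a b < ℓ c e
  dist-mono-< {a} {b} {c} {e} lt = ≰⇒> λ ce≤ab → <⇒≱ lt (‖‖²-mono⁻ (point c -ᵛ point e) (point a -ᵛ point b) ce≤ab)

  treeEdge⇒witness : ∀ {G p q} → IsMinimumSpanningTree G → Edge G q p → class p ≢ class q → Witness q p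
  treeEdge⇒witness {G} {p} {q} mst e p≢q = record
    { bichromatic = p≢q ; h = point q -ᵛ point p ; near = ≤-refl ; far = far }
    where
    far : ∀ s → s ≢ p → class s ≢ class q → ⟨ point q -ᵛ point p , point s -ᵛ point p ⟩ < ‖ point s -ᵛ point p ‖²
    -- The assumption a ≤ b puts s into the closed ball with diameter pq. The angle at s is then
    -- right or obtuse, and pq is strictly the longest side of the triangle.
    far s s≢p cₛ≢ = ≰⇒> λ a≤b → mst-lune-empty {G} mst e s≢q s≢p
      (dist-mono-< (0<-⇒< (<-resp refl lune₁ (+-nonneg-pos (twice a≤b) 0<a))))
      (dist-mono-< (0<-⇒< (<-resp refl lune₂ (+-nonneg-pos (twice a≤b) (separation s≢q)))))
      where
      s≢q : s ≢ q
      s≢q ≡.refl = cₛ≢ ≡.refl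
      a b c : ℝ
      a = ‖ point s -ᵛ point p ‖²
      b = ⟨ point q -ᵛ point p , point s -ᵛ point p ⟩
      c = ‖ point q -ᵛ point p ‖²
      0<a : 0# < a
      0<a = separation s≢p
      twice : a ≤ b → 0# ≤ (b -ʳ a) + (b -ʳ a)
      twice a≤b = +-nonneg (≤⇒0≤- a≤b) (≤⇒0≤- a≤b)

      law-of-cosines : ‖ point s -ᵛ point q ‖² ≈ a -ʳ (b + b) + c
      law-of-cosines = trans
        (⟨⟩-cong shift shift) (‖-‖² (point s -ᵛ point p) (point q -ᵛ point p))
        where
        shift : point s -ᵛ point q ≋ point s -ᵛ point p -ᵛ (point q -ᵛ point p)
        shift k = solve 3 (λ s q p → s :- q := s :- p :- (q :- p)) refl (point s k) (point q k) (point p k)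

      lune₁ : (b -ʳ a) + (b -ʳ a) + a ≈ c -ʳ ‖ point s -ᵛ point q ‖²
      lune₁ = trans (solve 3 (λ a b c → (b :- a) :+ (b :- a) :+ a := c :- (a :- (b :+ b) :+ c)) refl a b c)
        (+-congˡ (-‿cong (sym law-of-cosines)))

      lune₂ : (b -ʳ a) + (b -ʳ a) + ‖ point s -ᵛ point q ‖² ≈ c -ʳ a
      lune₂ = trans (+-congˡ law-of-cosines)
        (solve 3 (λ a b c → (b :- a) :+ (b :- a) :+ (a :- (b :+ b) :+ c) := c :- a) refl a b c)

  -- An invariant of the loop. It keeps the partner r inside R, which is what makes i relevant with
  -- respect to R as well.
  run-witness : ∀ {G R P} → IsMinimumSpanningTree G → Run G R P → ∀ i → i ∈ R → ∃[ r ] r ∈ R × Witness r i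
  run-witness {G} mst (initial R⇔) i i∈R =
    let j , e , i≢j = Equivalence.to (R⇔ i) i∈R
        e′ = edge-sym G i j e
    in j , Equivalence.from (R⇔ j) (i , e′ , i≢j ∘ ≡.sym) , treeEdge⇒witness {G} mst e′ i≢j
  run-witness mst (process {R} r E run r∈R _ E⇔) i i∈R∪E with x∈p∪q⁻ R E i∈R∪E
  ... | inj₁ i∈R = let s , s∈R , w = run-witness mst run i i∈R in s , x∈p∪q⁺ (inj₁ s∈R) , w
  ... | inj₂ i∈E with Equivalence.to (E⇔ i) i∈E
  -- The image of r is r itself, which was in R before this step.
  ...   | _ , itself , _           = let s , s∈R , w = run-witness mst run r r∈R in s , x∈p∪q⁺ (inj₁ s∈R) , w
  ...   | _ , other i≢r , extreme = r , x∈p∪q⁺ (inj₁ r∈R) , extreme⇒witness i≢r extreme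

lemma7 : (𝔽 : CompleteOrderedField) (d n : ℕ) (C : Set) → DecidableEquality C →
    (D : TrainingSet 𝔽 d n C) (R : Subset n) → Algorithm.Output D R →
    ∀ i → i ∈ R → NearestNeighbor.Relevant D ⊤ i × NearestNeighbor.Relevant D R i
lemma7 𝔽 d n C _≟_ D R (G , P , mst , run , _) i i∈R =
  let r , r∈R , w = run-witness mst run i i∈R
  in witness⇒relevant ⊤ ∈⊤ ∈⊤ w , witness⇒relevant R r∈R i∈R w
  where
  open Relevance _≟_ D using (witness⇒relevant)
  open Correctness _≟_ D using (run-witness)
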